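{- Let $n$ be a positive integer, and put $$r_1:=\left\lfloor\frac{3n-1-\sqrt{12n+13}}{3}\right\rfloor+1,\qquad r_2:=\left\lceil\frac{3n-1+\sqrt{12n+13}}{3}\right\rceil-1.$$ Then for every integer $m$ with $0\le m\le n$, $$a(m)=\sum_{\substack{k=r_1\\ k\equiv n\ (\mathrm{mod}\ 2)}}^{r_2}(-1)^{\frac{n-k}{2}}\sum_{r=0}^{m-1+\frac{3n^2+n}{2}}\mathfrak m(k;r)\,\mathfrak m_{odd}\!\left(\frac{3n-k}{2};\,m+\frac{3n^2+n}{2}-r\right).$$
   Context: Here $(a;q)_\infty:=\prod_{j=0}^\infty(1-aq^j)$. The integers $a(m)$ are defined by $$\sum_{m\ge0}a(m)q^m:=\frac{1}{\Theta_6(q)},\qquad \Theta_6(q):=(q;q)_\infty^3(q;q^2)_\infty^2 .$$ For integers $k\ge0$, $\mathfrak m(k;r)$ and $\mathfrak m_{odd}(k;r)$ denote the coefficients of $q^r$ in $A_k(q)$ and $C_k(q)$ respectively, where $$A_k(q):=\sum_{0<t_1<\cdots<t_k}\frac{q^{t_1+\cdots+t_k}}{(1-q^{t_1})^2\cdots(1-q^{t_k})^2},\qquad C_k(q):=\sum_{0<t_1<\cdots<t_k}\frac{q^{2t_1+\cdots+2t_k-k}}{(1-q^{2t_1-1})^2\cdots(1-q^{2t_k-1})^2},$$ and $A_0(q)=C_0(q)=1$. Equivalently, for $k\ge1$, $\mathfrak m(k;r)=\sum m_1m_2\cdots m_k$ over all $0<t_1<\cdots<t_k$ and positive integers $m_1,\dots,m_k$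 with $m_1t_1+\cdots+m_kt_k=r$, and $\mathfrak m_{odd}(k;r)=\sum m_1\cdots m_k$ over those with $m_1(2t_1-1)+\cdots+m_k(2t_k-1)=r$. -}

module Defs where

open import Data.Fin.Base using (Fin; zero; suc; toℕ)
open import Data.Integer.Base hiding (suc; _≤ᵇ_)
open import Data.Integer.Properties
open import Data.Integer.Tactic.RingSolver using (solve-∀)
open import Data.Nat.Base as ℕ using (ℕ; zero; suc; _∸_)
import Data.Nat.Properties as ℕ
import Data.Nat.Tactic.RingSolver as ℕ
open import Data.Product.Base using (Σ; _×_; _,_; proj₁; proj₂)
open import Data.Sign.Base as Sign using (Sign)
open import Data.Sum.Base using (_⊎_; inj₁; inj₂)
open import Data.Vec.Base as Vec using (Vec; []; _∷_)
open import Relation.Binary.PropositionalEquality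
open import Relation.Nullary.Decidable using (Dec; yes; no; does; _×-dec_; _⊎-dec_)
open import Relation.Nullary.Negation using (contradiction)
open import Data.Bool.Base using (if_then_else_)

open import Algebra.Properties.Semiring.Sum +-*-semiring public
  using (sum; sum-syntax; sum⁺-syntax; sum-cong-≗)

-- Formal power series in q over ℤ: f n is the coefficient of q^n

Series : Set
Series = ℕ → ℤ

infixl 7 _⊛_ _⊘_
infixr 8 _^ˢ_

_⊛_ : Series → Series → Series
(f ⊛ g) n = ∑[ i ≤ n ] (f (toℕ i) * g (n ∸ toℕ i))

q^ : ℕ → Series
q^ e n = if does (n ℕ.≟ e) then 1ℤ else 0ℤ

1ˢ : Series
1ˢ = q^ 0

1-q^ : ℕ → Series
1-q^ e n = 1ˢ n - q^ e n

_^ˢ_ : Series → ℕ → Series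
f ^ˢ zero  = 1ˢ
f ^ˢ suc k = f ⊛ f ^ˢ k

∏ : ∀ {k} → Vec Series k → Series
∏ = Vec.foldr′ _⊛_ 1ˢ

-- For f with constant term 1, recip f is 1/f (see ⊛-recip); for other f its
-- value is not meaningful.  recips f n lists the coefficients b_n, …, b_0,
-- obtained from b_{n+1} = - Σ_{i ≤ n} f_{i+1} b_{n-i}.

recips : Series → (n : ℕ) → Vec ℤ (suc n)
recips f zero    = 1ℤ ∷ []
recips f (suc n) =
  - (∑[ i ≤ n ] (f (suc (toℕ i)) * Vec.lookup (recips f n) i)) ∷ recips f n

recip : Series → Series
recip f n = Vec.head (recips f n)

_⊘_ : Series → Series → Series
f ⊘ g = f ⊛ recip g

lookup-recips : ∀ f n (i : Fin (suc n)) →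
                Vec.lookup (recips f n) i ≡ recip f (n ∸ toℕ i)
lookup-recips f zero    zero    = refl
lookup-recips f (suc n) zero    = refl
lookup-recips f (suc n) (suc i) = lookup-recips f n i

⊛-recip : ∀ f → f 0 ≡ 1ℤ → ∀ n → (f ⊛ recip f) n ≡ 1ˢ n
⊛-recip f f₀≡1 zero    rewrite f₀≡1 = refl
⊛-recip f f₀≡1 (suc n) rewrite f₀≡1 = begin
  1ℤ * (- S) + ∑[ i ≤ n ] (f (suc (toℕ i)) * recip f (n ∸ toℕ i))
    ≡⟨ cong₂ _+_ (*-identityˡ (- S))
         (sum-cong-≗ λ i → cong (f (suc (toℕ i)) *_) (sym (lookup-recips f n i))) ⟩
  - S + S
    ≡⟨ +-inverseˡ S ⟩
  0ℤ ∎
  where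
  open ≡-Reasoning
  S = ∑[ i ≤ n ] (f (suc (toℕ i)) * Vec.lookup (recips f n) i)

-- The limit of a sequence F of series such that the coefficient of q^n in
-- F T is the same for all T ≥ n.  This holds for both uses below: the factors,
-- respectively summands, that enter after stage n are ≡ 1, respectively ≡ 0,
-- modulo q^(n+1).

limit : (ℕ → Series) → Series
limit F n = F n n

-- (q^s ; q^b)_∞ = ∏_{j ≥ 0} (1 - q^(s + b j)), for s , b ≥ 1.

[q^_⨾q^_]∞ : ℕ → ℕ → Series
[q^ s ⨾q^ b ]∞ = limit λ J → ∏ (Vec.tabulate {n = J} λ j → 1-q^ (s ℕ.+ b ℕ.* toℕ j))

Θ₆ : Series
Θ₆ = [q^ 1 ⨾q^ 1 ]∞ ^ˢ 3 ⊛ [q^ 1 ⨾q^ 2 ]∞ ^ˢ 2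

a : ℕ → ℤ
a = 1ˢ ⊘ Θ₆

-- ∑< k s T F = Σ_{s < t₁ < ⋯ < t_k ≤ T} F (t₁ , … , t_k), as a nested sum.

∑< : (k s T : ℕ) → (Vec ℕ k → Series) → Series
∑< zero    s T F n = F [] n
∑< (suc k) s T F n =
  ∑[ i < T ∸ s ] (let t = suc s ℕ.+ toℕ i in ∑< k t T (λ ts → F (t ∷ ts)) n)

A : ℕ → Series
A k = limit λ T → ∑< k 0 T λ t →
  q^ (Vec.sum t) ⊘ ∏ (Vec.map (λ tᵢ → 1-q^ tᵢ ^ˢ 2) t)

C : ℕ → Series
C k = limit λ T → ∑< k 0 T λ t →
  q^ (Vec.sum (Vec.map (2 ℕ.*_) t) ∸ k) ⊘
    ∏ (Vec.map (λ tᵢ → 1-q^ (2 ℕ.* tᵢ ∸ 1) ^ˢ 2) t)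

𝔪 : ℕ → ℕ → ℤ
𝔪 k r = A k r

𝔪-odd : ℕ → ℕ → ℤ
𝔪-odd k r = C k r

-- surd p σ d c is the real number (p + σ√d) / c.

record Surd : Set where
  constructor surd
  field
    p : ℤ
    σ : Sign
    d : ℕ
    c : ℕ
    .{{c≢0}} : ℕ.NonZero c

-- w ≤ σ√d

_≤[_]√_ : ℤ → Sign → ℕ → Set
w ≤[ Sign.+ ]√ d = w ≤ 0ℤ ⊎ w * w ≤ + d
w ≤[ Sign.- ]√ d = w ≤ 0ℤ × + d ≤ w * w

-- z ≤ (p + σ√d) / c

infix 4 _≤ˢ_

_≤ˢ_ : ℤ → Surd → Set
z ≤ˢ surd p σ d c = (+ c * z - p) ≤[ σ ]√ d

-ˢ_ : Surd → Surd
-ˢ surd p σ d c = surd (- p) (Sign.opposite σ) d c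

IsFloor : Surd → ℤ → Set
IsFloor x f = f ≤ˢ x × (∀ z → z ≤ˢ x → z ≤ f)

private

  ≤√? : ∀ w σ d → Dec (w ≤[ σ ]√ d)
  ≤√? w Sign.+ d = (w ≤? 0ℤ) ⊎-dec (w * w ≤? + d)
  ≤√? w Sign.- d = (w ≤? 0ℤ) ×-dec (+ d ≤? w * w)

  n≤n*n : ∀ n → n ℕ.≤ n ℕ.* n
  n≤n*n zero    = ℕ.z≤n
  n≤n*n (suc n) = ℕ.m≤m*n (suc n) (suc n)

  ≤-d⇒≤√ : ∀ w σ d → w ≤ - + d → w ≤[ σ ]√ d
  ≤-d⇒≤√ w Sign.+ d w≤-d = inj₁ (≤-trans w≤-d (neg-≤-pos {d} {0}))
  ≤-d⇒≤√ w Sign.- d w≤-d = w≤0 , (begin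
    + d              ≤⟨ +≤+ (ℕ.≤-trans (n≤n*n d) (ℕ.*-mono-≤ d≤∣w∣ d≤∣w∣)) ⟩
    + (∣ w ∣ ℕ.* ∣ w ∣) ≡⟨ cong +_ (abs-* w w) ⟨
    + ∣ w * w ∣      ≡⟨ 0≤i⇒+∣i∣≡i (sq≥0 w) ⟩
    w * w            ∎)
    where
    open ≤-Reasoning
    w≤0 : w ≤ 0ℤ
    w≤0 = ≤-trans w≤-d (neg-≤-pos {d} {0})
    d≤∣w∣ : d ℕ.≤ ∣ w ∣
    d≤∣w∣ = drop‿+≤+ (begin
      + d       ≡⟨ neg-involutive (+ d) ⟨
      - - + d   ≤⟨ neg-mono-≤ w≤-d ⟩
      - w       ≡⟨ 0≤i⇒+∣i∣≡i (neg-mono-≤ w≤0) ⟨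
      + ∣ - w ∣ ≡⟨ cong +_ (∣-i∣≡∣i∣ w) ⟩
      + ∣ w ∣   ∎)
    sq≥0 : ∀ i → 0ℤ ≤ i * i
    sq≥0 (+ n)    = ≤-trans (+≤+ ℕ.z≤n) (≤-reflexive (pos-* n n))
    sq≥0 -[1+ n ] = +≤+ ℕ.z≤n

  ≤√⇒≤d : ∀ w σ d → w ≤[ σ ]√ d → w ≤ + d
  ≤√⇒≤d w Sign.+ d (inj₁ w≤0)       = ≤-trans w≤0 (+≤+ ℕ.z≤n)
  ≤√⇒≤d (+ n) Sign.+ d (inj₂ w²≤d)  =
    ≤-trans (+≤+ (n≤n*n n)) (≤-trans (≤-reflexive (pos-* n n)) w²≤d)
  ≤√⇒≤d -[1+ n ] Sign.+ d (inj₂ _)  = -≤+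
  ≤√⇒≤d w Sign.- d (w≤0 , _)        = ≤-trans w≤0 (+≤+ ℕ.z≤n)

  -- The greatest z ≤ hi with P z, searching down from hi.
  greatest : (P : ℤ → Set) → (∀ z → Dec (P z)) → ∀ hi steps →
             P (hi - + steps) → (∀ z → P z → z ≤ hi) →
             Σ ℤ λ f → P f × (∀ z → P z → z ≤ f)
  greatest P P? hi steps Plo ub with P? hi
  ... | yes Phi = hi , Phi , ub
  greatest P P? hi zero Plo ub | no ¬Phi =
    contradiction (subst P (+-identityʳ hi) Plo) ¬Phi
  greatest P P? hi (suc steps) Plo ub | no ¬Phi =
    greatest P P? (pred hi) steps (subst P eq Plo) λ z Pz →
      i<j⇒i≤pred[j] (≤∧≢⇒< (ub z Pz) λ { refl → ¬Phi Pz })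
    where
    eq : hi - + suc steps ≡ pred hi - + steps
    eq = begin
      hi - + suc steps       ≡⟨ cong (λ u → hi + u) (neg-distrib-+ 1ℤ (+ steps)) ⟩
      hi + (-1ℤ - + steps)   ≡⟨ +-assoc hi -1ℤ (- + steps) ⟨
      hi + -1ℤ - + steps     ≡⟨ cong (_- + steps) (+-comm hi -1ℤ) ⟩
      pred hi - + steps      ∎
      where open ≡-Reasoning

floor : ∀ x → Σ ℤ (IsFloor x)
floor x@(surd p σ d c) =
  greatest (_≤ˢ x) (λ z → ≤√? (+ c * z - p) σ d) (+ B) (B ℕ.+ B) lo hi
  where
  open ≤-Reasoning

  B : ℕ
  B = ∣ p ∣ ℕ.+ d

  p≤ : ∀ i → i ≤ + ∣ i ∣
  p≤ (+ n)    = ≤-refl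
  p≤ -[1+ n ] = -≤+

  B≤cB : + B ≤ + c * + B
  B≤cB = ≤-trans (+≤+ (ℕ.m≤n*m B c)) (≤-reflexive (pos-* c B))

  lo : (+ B - + (B ℕ.+ B)) ≤ˢ x
  lo = ≤-d⇒≤√ _ σ d (begin
    + c * (+ B - + (B ℕ.+ B)) - p      ≡⟨ cong (λ u → + c * u - p) eq ⟩
    + c * (- + B) - p                  ≡⟨ cong (_- p) (neg-distribʳ-* (+ c) (+ B)) ⟨
    - (+ c * + B) - p                  ≤⟨ +-mono-≤ (neg-mono-≤ B≤cB) (p≤ (- p)) ⟩
    - + B + + ∣ - p ∣                  ≡⟨ cong₂ (λ u v → u + + v)
                                            (neg-distrib-+ (+ ∣ p ∣) (+ d)) (∣-i∣≡∣i∣ p) ⟩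
    - + ∣ p ∣ + - + d + + ∣ p ∣        ≡⟨ +-comm (- + ∣ p ∣ + - + d) (+ ∣ p ∣) ⟩
    + ∣ p ∣ + (- + ∣ p ∣ + - + d)      ≡⟨ +-assoc (+ ∣ p ∣) (- + ∣ p ∣) (- + d) ⟨
    + ∣ p ∣ - + ∣ p ∣ + - + d          ≡⟨ cong (_+ - + d) (+-inverseʳ (+ ∣ p ∣)) ⟩
    0ℤ + - + d                         ≡⟨ +-identityˡ (- + d) ⟩
    - + d                              ∎)
    where
    eq : + B - + (B ℕ.+ B) ≡ - + B
    eq = trans (cong (λ u → + B + u) (neg-distrib-+ (+ B) (+ B)))
        (trans (sym (+-assoc (+ B) (- + B) (- + B)))
        (trans (cong (_+ - + B) (+-inverseʳ (+ B))) (+-identityˡ (- + B))))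

  hi : ∀ z → z ≤ˢ x → z ≤ + B
  hi -[1+ n ] _   = -≤+
  hi (+ n)    z≤x = begin
    + n                   ≤⟨ +≤+ (ℕ.m≤n*m n c) ⟩
    + (c ℕ.* n)           ≡⟨ pos-* c n ⟩
    + c * + n             ≡⟨ +-identityʳ (+ c * + n) ⟨
    + c * + n + 0ℤ        ≡⟨ cong (λ u → + c * + n + u) (+-inverseˡ p) ⟨
    + c * + n + (- p + p) ≡⟨ +-assoc (+ c * + n) (- p) p ⟨
    + c * + n - p + p     ≤⟨ +-mono-≤ (≤√⇒≤d _ σ d z≤x) (p≤ p) ⟩
    + d + + ∣ p ∣         ≡⟨ +-comm (+ d) (+ ∣ p ∣) ⟩
    + B                   ∎

⌊_⌋ ⌈_⌉ : Surd → ℤ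
⌊ x ⌋ = proj₁ (floor x)
⌈ x ⌉ = - ⌊ -ˢ x ⌋

⌊⌋-greatest : ∀ x z → z ≤ˢ x → z ≤ ⌊ x ⌋
⌊⌋-greatest x = proj₂ (proj₂ (floor x))

-- (3n - 1 + σ√(12n+13)) / 3

root : Sign → ℕ → Surd
root σ n = surd (+ 3 * + n - 1ℤ) σ (12 ℕ.* n ℕ.+ 13) 3

r₁ r₂ : ℕ → ℤ
r₁ n = ⌊ root Sign.- n ⌋ + 1ℤ
r₂ n = ⌈ root Sign.+ n ⌉ - 1ℤ

-- For k in the summation range, k and 3n - k are therefore nonnegative, so
-- ∣ k ∣ and ∣ (3n - k) / 2 ∣ in the statement lose nothing.

private

  -e≤-√d : ∀ e d → d ℕ.≤ e ℕ.* e → (- + e) ≤[ Sign.- ]√ d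
  -e≤-√d e d d≤e² = neg-≤-pos {e} {0} , ≤-trans (+≤+ d≤e²) (≤-reflexive (begin
    + (e ℕ.* e)         ≡⟨ pos-* e e ⟩
    + e * + e           ≡⟨ neg-involutive (+ e * + e) ⟨
    - - (+ e * + e)     ≡⟨ cong -_ (neg-distribʳ-* (+ e) (+ e)) ⟩
    - (+ e * - + e)     ≡⟨ neg-distribˡ-* (+ e) (- + e) ⟩
    - + e * - + e       ∎))
    where open ≡-Reasoning

0≤r₁ : ∀ n → 1 ℕ.≤ n → 0ℤ ≤ r₁ n
0≤r₁ n@(suc k) _ = +-monoˡ-≤ 1ℤ (⌊⌋-greatest (root Sign.- n) -1ℤ
  (subst (_≤[ Sign.- ]√ (12 ℕ.* n ℕ.+ 13)) (sym w)
    (-e≤-√d e _ (ℕ.≤-trans (ℕ.m≤m+n _ _) (ℕ.≤-reflexive (square k))))))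
  where
  e = 3 ℕ.* n ℕ.+ 2
  square : ∀ k → 12 ℕ.* suc k ℕ.+ 13 ℕ.+ (9 ℕ.* k ℕ.* k ℕ.+ 18 ℕ.* k) ≡
                 (3 ℕ.* suc k ℕ.+ 2) ℕ.* (3 ℕ.* suc k ℕ.+ 2)
  square = ℕ.solve-∀
  shift : ∀ x → + 3 * -1ℤ - (x - 1ℤ) ≡ - (x + + 2)
  shift = solve-∀
  w : + 3 * -1ℤ - (+ 3 * + n - 1ℤ) ≡ - + e
  w = trans (shift (+ 3 * + n)) (cong (λ u → - (u + + 2)) (sym (pos-* 3 n)))

r₂≤3n : ∀ n → r₂ n ≤ + (3 ℕ.* n)
r₂≤3n n = begin
  - ⌊ x ⌋ - 1ℤ         ≤⟨ +-monoˡ-≤ -1ℤ (neg-mono-≤ (⌊⌋-greatest x z z≤x)) ⟩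
  - z - 1ℤ             ≡⟨ cancel (+ 3 * + n) ⟩
  + 3 * + n            ≡⟨ pos-* 3 n ⟨
  + (3 ℕ.* n)          ∎
  where
  open ≤-Reasoning
  x = -ˢ root Sign.+ n
  z = - (+ 3 * + n + 1ℤ)
  e = 6 ℕ.* n ℕ.+ 4
  cancel : ∀ y → - - (y + 1ℤ) - 1ℤ ≡ y
  cancel = solve-∀
  square : ∀ n → 12 ℕ.* n ℕ.+ 13 ℕ.+ (36 ℕ.* n ℕ.* n ℕ.+ 36 ℕ.* n ℕ.+ 3) ≡
                 (6 ℕ.* n ℕ.+ 4) ℕ.* (6 ℕ.* n ℕ.+ 4)
  square = ℕ.solve-∀
  shift : ∀ y → + 3 * (- (+ 3 * y + 1ℤ)) - (- (+ 3 * y - 1ℤ)) ≡ - (+ 6 * y + + 4)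
  shift = solve-∀
  w : + 3 * z - (- (+ 3 * + n - 1ℤ)) ≡ - + e
  w = trans (shift (+ n)) (cong (λ u → - (u + + 4)) (sym (pos-* 6 n)))
  z≤x : z ≤ˢ x
  z≤x = subst (_≤[ Sign.- ]√ (12 ℕ.* n ℕ.+ 13)) (sym w)
    (-e≤-√d e _ (ℕ.≤-trans (ℕ.m≤m+n _ _) (ℕ.≤-reflexive (square n))))

-- Σ_{k = lo}^{hi} F k over integers k, empty if hi < lo

∑ℤ : (lo hi : ℤ) → (ℤ → ℤ) → ℤ
∑ℤ lo hi F = ∑[ i < ∣ (hi - lo + 1ℤ) ⊔ 0ℤ ∣ ] F (lo + + toℕ i)

-- For k → ∞ the series A k and C k are determined by their leading behaviour:
-- with Q = (q;q)_∞, D = (q;q²)_∞ and P = (q²;q²)_∞,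
--
--   A k ≡ q^(k(k+1)/2) / Q³        modulo q^(k(k+1)/2 + k + 1),
--   C j ≡ q^(j²) / (D² P)          modulo q^(j² + 2j + 1).
--
-- Both follow from the recurrence of elementary symmetric functions in the
-- number of variables.  For k = n + 2s and j = n - s the exponents add up to
-- (3n² + n)/2 + 3s² + s, and the two errors lie beyond q^((3n² + n)/2 + n), so up
-- to that power A k C j is q^((3n² + n)/2) q^(3s² + s) / (Θ₆ P).  The condition
-- r₁ ≤ k ≤ r₂ says 3s² + s ≤ n.  The pentagonal number theorem
-- Σ (-1)^s q^(3s² + s) = P, used in Shanks' finite form, leaves 1/Θ₆.

module Submission where

open import Algebra.Bundles using (CommutativeRing)
import Algebra.Properties.Semiring.Sum as SemiringSum
import Algebra.Solver.Ring as RingSolver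
open import Algebra.Solver.Ring.AlmostCommutativeRing
  using (fromCommutativeRing; _-Raw-AlmostCommutative⟶_)
open import Data.Bool.Base using (if_then_else_)
open import Data.Fin.Base using (toℕ)
import Data.Fin.Properties as Fin
open import Data.Integer.Base hiding (suc; _≤ᵇ_)
open import Data.Integer.Divisibility.Signed as Signed using (_∣?_; divides)
open import Data.Integer.DivMod using (_/_; a≡a%n+[a/n]*n; n%d<d)
open import Data.Integer.Properties
open import Data.Integer.Tactic.RingSolver using (solve-∀)
open import Data.Maybe.Base using (Maybe; just; nothing)
open import Data.Nat.Base as ℕ using (ℕ; zero; suc; _∸_)
import Data.Nat.DivMod as ℕ
import Data.Nat.Properties as ℕ
import Data.Nat.Tactic.RingSolver as ℕ
open import Data.Product.Base using (_×_; _,_; proj₁; proj₂)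
open import Data.Sign.Base as Sign using ()
open import Data.Vec.Base as Vec using (Vec; []; _∷_)
open import Data.Vec.Properties using (map-id)
open import Data.Vec.Relation.Unary.All using (All; []; _∷_)
open import Level using (0ℓ)
open import Relation.Binary.Bundles using (Setoid)
import Relation.Binary.Reasoning.Setoid as SetoidReasoning
open import Relation.Binary.PropositionalEquality
open import Relation.Nullary.Decidable using (Dec; yes; no; does; dec-true; dec-false)
open import Relation.Nullary.Negation using (¬_; contradiction)
open import Defs

open SemiringSum +-*-semiring
  using (*-distribˡ-sum; ∑-distrib-+)

-- The exponents in `Θ₆` have two origins. The squares `Q²` and `D²` clear the squared denominators
-- of `A k` and `C j`; the further `Q` and `P` come from the recurrence itself, whose solution tends
-- to 1/(q^b;q^b)_∞ after division by the leading power. Of these, `P` does not belong to `Θ₆`, and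
-- the pentagonal sum is there to remove it.
--
-- The obstacle is precision: relative to its leading power, `A k` is known only modulo q^(k + 1),
-- which gets worse as k decreases. The rise of the leading exponent compensates, since 3s² + s + (k
-- + 1) = n + 1 + 3s(s + 1) and 3s² + s + (2j + 1) = 2n + 1 + s(3s - 1), and both exceed n for every
-- integer s. At s = 0 the first of them equals n + 1, which matches the bound m ≤ n.
--
-- The sum over k extends by zeros to k = n + 2s with -n ≤ s ≤ n. This is exactly the range of
-- Shanks' finite sum, so no infinite sum over s occurs.

private
  variable
    n N : ℕ
    f f′ g g′ h : Series

-- The ring of formal power series

infixl 6 _⊕_
infix 8 ⊝_
infixr 7 _·_

_⊕_ : Series → Series → Series
(f ⊕ g) n = f n + g n

⊝_ : Series → Series
(⊝ f) n = - f n

_·_ : ℤ → Series → Series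
(c · f) n = c * f n

-- The coefficient embedding for the ring solver. `constant 1ℤ` and `1ˢ` agree coefficient by
-- coefficient but not by computation.
constant : ℤ → Series
constant c zero    = c
constant c (suc _) = 0ℤ

0ˢ : Series
0ˢ = constant 0ℤ

0ˢ≡0 : ∀ n → 0ˢ n ≡ 0ℤ
0ˢ≡0 zero    = refl
0ˢ≡0 (suc _) = refl

tail : Series → Series
tail f n = f (suc n)

⊛-cong-≤ : ∀ n → (∀ i → i ℕ.≤ n → f i ≡ f′ i) → (∀ i → i ℕ.≤ n → g i ≡ g′ i) →
           (f ⊛ g) n ≡ (f′ ⊛ g′) n
⊛-cong-≤ n f≡ g≡ = sum-cong-≗ {suc n} λ i →
  cong₂ _*_ (f≡ (toℕ i) (ℕ.≤-pred (Fin.toℕ<n i))) (g≡ (n ∸ toℕ i) (ℕ.m∸n≤m n (toℕ i)))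

⊛-cong : f ≗ f′ → g ≗ g′ → f ⊛ g ≗ f′ ⊛ g′
⊛-cong f≗ g≗ n = ⊛-cong-≤ n (λ i _ → f≗ i) (λ i _ → g≗ i)

0-⊛ : (∀ n → f n ≡ 0ℤ) → ∀ g n → (f ⊛ g) n ≡ 0ℤ
0-⊛ f≡0 g zero    rewrite f≡0 0 = refl
0-⊛ f≡0 g (suc n) rewrite f≡0 0 =
  trans (+-identityˡ _) (0-⊛ (λ i → f≡0 (suc i)) g n)

⊛-identityˡ : ∀ f → 1ˢ ⊛ f ≗ f
⊛-identityˡ f zero    = trans (+-identityʳ _) (*-identityˡ (f 0))
⊛-identityˡ f (suc n) = trans
  (cong₂ _+_ (*-identityˡ (f (suc n))) (0-⊛ (λ _ → refl) f n)) (+-identityʳ _)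

⊛-distribʳ : ∀ h f g → (f ⊕ g) ⊛ h ≗ f ⊛ h ⊕ g ⊛ h
⊛-distribʳ h f g n = trans
  (sum-cong-≗ {suc n} λ i → *-distribʳ-+ (h (n ∸ toℕ i)) (f (toℕ i)) (g (toℕ i)))
  (∑-distrib-+ {suc n} (λ i → f (toℕ i) * h (n ∸ toℕ i)) (λ i → g (toℕ i) * h (n ∸ toℕ i)))

·-⊛ : ∀ c f g → (c · f) ⊛ g ≗ c · (f ⊛ g)
·-⊛ c f g n = trans
  (sum-cong-≗ {suc n} λ i → *-assoc c (f (toℕ i)) (g (n ∸ toℕ i)))
  (sym (*-distribˡ-sum {suc n} c (λ i → f (toℕ i) * g (n ∸ toℕ i))))

-- The convolution unfolds only at its first index, where `f 0` occurs. Splitting off the last term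
-- instead gives the mirror recursion, and `⊛-comm` follows by matching the two.
⊛-sucʳ : ∀ f g n → (f ⊛ g) (suc n) ≡ (f ⊛ tail g) n + f (suc n) * g 0
⊛-sucʳ f g zero    = lemma (f 0 * g 1) (f 1 * g 0)
  where
  lemma : ∀ x y → x + (y + 0ℤ) ≡ x + 0ℤ + y
  lemma = solve-∀
⊛-sucʳ f g (suc n) = trans (cong (λ u → f 0 * g (suc (suc n)) + u) (⊛-sucʳ (tail f) g n))
  (sym (+-assoc (f 0 * g (suc (suc n))) _ _))

⊛-comm : ∀ f g → f ⊛ g ≗ g ⊛ f
⊛-comm f g zero    = cong (_+ 0ℤ) (*-comm (f 0) (g 0))
⊛-comm f g (suc n) = begin
  f 0 * g (suc n) + (tail f ⊛ g) n  ≡⟨ cong₂ _+_ (*-comm (f 0) (g (suc n))) (⊛-comm (tail f) g n) ⟩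
  g (suc n) * f 0 + (g ⊛ tail f) n  ≡⟨ +-comm (g (suc n) * f 0) _ ⟩
  (g ⊛ tail f) n + g (suc n) * f 0  ≡⟨ ⊛-sucʳ g f n ⟨
  (g ⊛ f) (suc n)                   ∎
  where open ≡-Reasoning

⊛-assoc : ∀ f g h → (f ⊛ g) ⊛ h ≗ f ⊛ (g ⊛ h)
⊛-assoc f g h zero    = lemma (f 0) (g 0) (h 0)
  where
  lemma : ∀ x y z → (x * y + 0ℤ) * z + 0ℤ ≡ x * (y * z + 0ℤ) + 0ℤ
  lemma = solve-∀
⊛-assoc f g h (suc n) = begin
  -- By computation, `f 0 · tail g ⊕ tail f ⊛ g` is the tail of `f ⊛ g`; the induction hypothesis
  -- applies to its second summand.
  (f 0 * g 0 + 0ℤ) * h (suc n) + ((f 0 · tail g ⊕ tail f ⊛ g) ⊛ h) n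
    ≡⟨ cong (λ u → (f 0 * g 0 + 0ℤ) * h (suc n) + u) (begin
         ((f 0 · tail g ⊕ tail f ⊛ g) ⊛ h) n
           ≡⟨ ⊛-distribʳ h (f 0 · tail g) (tail f ⊛ g) n ⟩
         ((f 0 · tail g) ⊛ h) n + (tail f ⊛ g ⊛ h) n
           ≡⟨ cong₂ _+_ (·-⊛ (f 0) (tail g) h n) (⊛-assoc (tail f) g h n) ⟩
         f 0 * (tail g ⊛ h) n + (tail f ⊛ (g ⊛ h)) n ∎) ⟩
  (f 0 * g 0 + 0ℤ) * h (suc n) + (f 0 * (tail g ⊛ h) n + (tail f ⊛ (g ⊛ h)) n)
    ≡⟨ lemma (f 0) (g 0) (h (suc n)) _ _ ⟩
  f 0 * (g 0 * h (suc n) + (tail g ⊛ h) n) + (tail f ⊛ (g ⊛ h)) n ∎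
  where
  open ≡-Reasoning
  lemma : ∀ x y z u v → (x * y + 0ℤ) * z + (x * u + v) ≡ x * (y * z + u) + v
  lemma = solve-∀

-- f ≈[ N ] g: congruence modulo q^N.  Both relations are records so that
-- the two series can be inferred from the type of a proof.

infix 4 _≈_ _≈[_]_

record _≈_ (f g : Series) : Set where
  constructor pointwise
  field coeff : f ≗ g

record _≈[_]_ (f : Series) (N : ℕ) (g : Series) : Set where
  constructor below
  field coeff< : n ℕ.< N → f n ≡ g n

open _≈_
open _≈[_]_

Series-commutativeRing : CommutativeRing 0ℓ 0ℓ
Series-commutativeRing = record
  { Carrier = Series
  ; _≈_ = _≈_
  ; _+_ = _⊕_
  ; _*_ = _⊛_
  ; -_  = ⊝_
  ; 0#  = 0ˢ
  ; 1#  = 1ˢ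
  ; isCommutativeRing = record
    { isRing = record
      { +-isAbelianGroup = record
        { isGroup = record
          { isMonoid = record
            { isSemigroup = record
              { isMagma = record
                { isEquivalence = record
                  { refl  = pointwise λ _ → refl
                  ; sym   = λ p → pointwise λ n → sym (coeff p n)
                  ; trans = λ p r → pointwise λ n → trans (coeff p n) (coeff r n)
                  }
                ; ∙-cong = λ p r → pointwise λ n → cong₂ _+_ (coeff p n) (coeff r n)
                }
              ; assoc = λ f g h → pointwise λ n → +-assoc (f n) (g n) (h n)
              }
            ; identity = (λ f → pointwise (0⊕ f)) ,
                         (λ f → pointwise λ n → trans (+-comm (f n) _) (0⊕ f n))
            }
          ; inverse = (λ f → pointwise (⊝f⊕f f)) ,
                      (λ f → pointwise λ n → trans (+-comm (f n) _) (⊝f⊕f f n))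
          ; ⁻¹-cong = λ p → pointwise λ n → cong -_ (coeff p n)
          }
        ; comm = λ f g → pointwise λ n → +-comm (f n) (g n)
        }
      ; *-cong = λ p r → pointwise (⊛-cong (coeff p) (coeff r))
      ; *-assoc = λ f g h → pointwise (⊛-assoc f g h)
      ; *-identity = (λ f → pointwise (⊛-identityˡ f)) ,
                     (λ f → pointwise λ n → trans (⊛-comm f 1ˢ n) (⊛-identityˡ f n))
      ; distrib = (λ f g h → pointwise λ n → trans (⊛-comm f (g ⊕ h) n)
                     (trans (⊛-distribʳ f g h n)
                       (cong₂ _+_ (⊛-comm g f n) (⊛-comm h f n)))) ,
                  (λ f g h → pointwise (⊛-distribʳ f g h))
      }
    ; *-comm = λ f g → pointwise (⊛-comm f g)
    }
  }
  where
  0⊕ : ∀ f → 0ˢ ⊕ f ≗ f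
  0⊕ f n = trans (cong (_+ f n) (0ˢ≡0 n)) (+-identityˡ (f n))

  ⊝f⊕f : ∀ f → ⊝ f ⊕ f ≗ 0ˢ
  ⊝f⊕f f n = trans (+-inverseˡ (f n)) (sym (0ˢ≡0 n))

module R = CommutativeRing Series-commutativeRing

constant-homomorphism :
  +-*-rawRing -Raw-AlmostCommutative⟶ fromCommutativeRing Series-commutativeRing
constant-homomorphism = record
  { ⟦_⟧    = constant
  ; +-homo = λ c d → pointwise λ where zero → refl ; (suc n) → refl
  ; *-homo = λ c d → pointwise λ where
      zero    → sym (+-identityʳ (c * d))
      (suc n) → sym (trans (cong₂ _+_ (*-zeroʳ c) (0-⊛ (λ _ → refl) (constant d) n)) refl)
  ; -‿homo = λ c → pointwise λ where zero → refl ; (suc n) → refl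
  ; 0-homo = R.refl
  ; 1-homo = pointwise λ where zero → refl ; (suc n) → refl
  }

constant-≟ : ∀ c d → Maybe (constant c ≈ constant d)
constant-≟ c d with c ≟ d
... | yes refl = just R.refl
... | no _     = nothing

⊛-congˡ : ∀ h → f ≈ g → h ⊛ f ≈ h ⊛ g
⊛-congˡ h = R.*-cong (R.refl {h})

⊛-congʳ : ∀ h → f ≈ g → f ⊛ h ≈ g ⊛ h
⊛-congʳ h p = R.*-cong p (R.refl {h})

module Solver = RingSolver +-*-rawRing (fromCommutativeRing Series-commutativeRing)
  constant-homomorphism constant-≟


-- Congruences modulo powers of q

module _ {N : ℕ} where

  ≈[]-setoid : Setoid 0ℓ 0ℓ
  ≈[]-setoid = record
    { Carrier = Series
    ; _≈_ = _≈[ N ]_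
    ; isEquivalence = record
      { refl  = below λ _ → refl
      ; sym   = λ p → below λ n<N → sym (coeff< p n<N)
      ; trans = λ p r → below λ n<N → trans (coeff< p n<N) (coeff< r n<N)
      }
    }

  open Setoid ≈[]-setoid public
    using () renaming (refl to ≈[]-refl; sym to ≈[]-sym; trans to ≈[]-trans)

  ≈⇒≈[] : f ≈ g → f ≈[ N ] g
  ≈⇒≈[] p = below λ {n} _ → coeff p n

  ⊕-cong[] : f ≈[ N ] f′ → g ≈[ N ] g′ → f ⊕ g ≈[ N ] f′ ⊕ g′
  ⊕-cong[] p r = below λ n<N → cong₂ _+_ (coeff< p n<N) (coeff< r n<N)

  ⊛-cong[] : f ≈[ N ] f′ → g ≈[ N ] g′ → f ⊛ g ≈[ N ] f′ ⊛ g′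
  ⊛-cong[] p r = below λ {n} n<N → ⊛-cong-≤ n
    (λ i i≤n → coeff< p (ℕ.≤-<-trans i≤n n<N))
    (λ i i≤n → coeff< r (ℕ.≤-<-trans i≤n n<N))

  ⊛-congˡ[] : ∀ h → f ≈[ N ] g → h ⊛ f ≈[ N ] h ⊛ g
  ⊛-congˡ[] h = ⊛-cong[] (≈[]-refl {h})

  ⊛-congʳ[] : ∀ h → f ≈[ N ] g → f ⊛ h ≈[ N ] g ⊛ h
  ⊛-congʳ[] h p = ⊛-cong[] p (≈[]-refl {h})

≈[]-weaken : ∀ {M} → M ℕ.≤ N → f ≈[ N ] g → f ≈[ M ] g
≈[]-weaken M≤N p = below λ n<M → coeff< p (ℕ.<-≤-trans n<M M≤N)

module ≈-Reasoning = SetoidReasoning R.setoid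
module ≈[]-Reasoning (N : ℕ) = SetoidReasoning (≈[]-setoid {N})

q^suc-⊛ : ∀ e f n → (q^ (suc e) ⊛ f) (suc n) ≡ (q^ e ⊛ f) n
q^suc-⊛ e f n = +-identityˡ ((q^ e ⊛ f) n)

q^-⊛-coeff : ∀ e f m → (q^ e ⊛ f) (e ℕ.+ m) ≡ f m
q^-⊛-coeff zero    f m = ⊛-identityˡ f m
q^-⊛-coeff (suc e) f m = trans (q^suc-⊛ e f (e ℕ.+ m)) (q^-⊛-coeff e f m)

q^-+ : ∀ d e → q^ d ⊛ q^ e ≈ q^ (d ℕ.+ e)
q^-+ d e = pointwise (go d)
  where
  go : ∀ d → q^ d ⊛ q^ e ≗ q^ (d ℕ.+ e)
  go zero    n       = ⊛-identityˡ (q^ e) n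
  go (suc d) zero    = refl
  go (suc d) (suc n) = trans (q^suc-⊛ d (q^ e) n) (go d n)

q^-⊛-cong[] : ∀ e → f ≈[ N ] g → q^ e ⊛ f ≈[ e ℕ.+ N ] q^ e ⊛ g
q^-⊛-cong[] {f} {N} {g} e p = below λ {n} → go e n
  where
  go : ∀ e n → n ℕ.< e ℕ.+ N → (q^ e ⊛ f) n ≡ (q^ e ⊛ g) n
  go zero    n       n<N = coeff< (⊛-congˡ[] 1ˢ p) n<N
  go (suc e) zero    _   = refl
  go (suc e) (suc n) n<  = trans (q^suc-⊛ e f n)
    (trans (go e n (ℕ.s<s⁻¹ n<)) (sym (q^suc-⊛ e g n)))

q^-⊛-≈0 : ∀ e f → N ℕ.≤ e → q^ e ⊛ f ≈[ N ] 0ˢ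
q^-⊛-≈0 {N} e f N≤e = ≈[]-weaken (ℕ.≤-trans N≤e (ℕ.m≤m+n e 0)) (≈[]-trans
  (q^-⊛-cong[] {f} {0} {0ˢ} e (below λ ()))
  (≈⇒≈[] (R.zeroʳ (q^ e))))

q^-≈0 : ∀ e → N ℕ.≤ e → q^ e ≈[ N ] 0ˢ
q^-≈0 e N≤e = ≈[]-trans (≈⇒≈[] (R.sym (R.*-identityʳ (q^ e)))) (q^-⊛-≈0 e 1ˢ N≤e)

-- Brings `1-q^ e` into the form that the solver reads as `con 1ℤ :+ :- y`.
1-q^-def : ∀ e → 1-q^ e ≈ constant 1ℤ ⊕ ⊝ q^ e
1-q^-def e = pointwise λ where zero → refl ; (suc n) → refl

1-q^-≈1 : ∀ e → N ℕ.≤ e → 1-q^ e ≈[ N ] 1ˢ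
1-q^-≈1 {N} e N≤e = below λ {n} n<N → trans
  (cong (λ u → 1ˢ n - u) (trans (coeff< (q^-≈0 e N≤e) n<N) (0ˢ≡0 n))) (+-identityʳ (1ˢ n))

-- Series with constant term 1

record Unital (f : Series) : Set where
  constructor unital
  field constantTerm : f 0 ≡ 1ℤ

1-unital : Unital 1ˢ
1-unital = unital refl

1-q^-unital : ∀ e .{{_ : ℕ.NonZero e}} → Unital (1-q^ e)
1-q^-unital (suc e) = unital refl

⊛-unital : Unital f → Unital g → Unital (f ⊛ g)
⊛-unital (unital f₀) (unital g₀) = unital (cong₂ (λ x y → x * y + 0ℤ) f₀ g₀)

^ˢ-unital : ∀ k → Unital f → Unital (f ^ˢ k)
^ˢ-unital zero    f₀ = 1-unital
^ˢ-unital (suc k) f₀ = ⊛-unital f₀ (^ˢ-unital k f₀)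

⊛-inverseʳ : Unital f → f ⊛ recip f ≈ 1ˢ
⊛-inverseʳ {f} (unital f₀) = pointwise (⊛-recip f f₀)

⊛-cancelʳ : Unital h → f ⊛ h ≈[ N ] g → f ≈[ N ] g ⊛ recip h
⊛-cancelʳ {h} {f} {N} {g} h₀ p = begin
  f                   ≈⟨ ≈⇒≈[] (R.*-identityʳ f) ⟨
  f ⊛ 1ˢ              ≈⟨ ⊛-congˡ[] f (≈⇒≈[] (⊛-inverseʳ h₀)) ⟨
  f ⊛ (h ⊛ recip h)   ≈⟨ ≈⇒≈[] (R.*-assoc f h (recip h)) ⟨
  f ⊛ h ⊛ recip h     ≈⟨ ⊛-congʳ[] (recip h) p ⟩
  g ⊛ recip h         ∎
  where open ≈[]-Reasoning N

recip-unique : Unital f → f ⊛ g ≈ 1ˢ → g ≈ recip f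
recip-unique {f} {g} f₀ p = begin
  g                  ≈⟨ R.*-identityˡ g ⟨
  1ˢ ⊛ g             ≈⟨ ⊛-congʳ g (⊛-inverseʳ f₀) ⟨
  f ⊛ recip f ⊛ g    ≈⟨ solve 3 (λ x y z → x :* y :* z := x :* z :* y) R.refl f (recip f) g ⟩
  f ⊛ g ⊛ recip f    ≈⟨ ⊛-congʳ (recip f) p ⟩
  1ˢ ⊛ recip f       ≈⟨ R.*-identityˡ (recip f) ⟩
  recip f            ∎
  where
  open ≈-Reasoning
  open Solver

recip-⊛ : Unital f → Unital g → recip (f ⊛ g) ≈ recip f ⊛ recip g
recip-⊛ {f} {g} f₀ g₀ = R.sym (recip-unique (⊛-unital f₀ g₀) (begin
  (f ⊛ g) ⊛ (recip f ⊛ recip g)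
    ≈⟨ solve 4 (λ x y z w → x :* y :* (z :* w) := x :* z :* (y :* w)) R.refl f g (recip f) (recip g) ⟩
  (f ⊛ recip f) ⊛ (g ⊛ recip g)
    ≈⟨ R.*-cong (⊛-inverseʳ f₀) (⊛-inverseʳ g₀) ⟩
  1ˢ ⊛ 1ˢ
    ≈⟨ R.*-identityˡ 1ˢ ⟩
  1ˢ ∎))
  where
  open ≈-Reasoning
  open Solver

-- Limits and infinite products

limit-≈[] : ∀ {F} → (∀ T → F (suc T) ≈[ suc T ] F T) → ∀ T → limit F ≈[ suc T ] F T
limit-≈[] {F} stable T = below λ {n} n≤T →
  subst (λ t → F n n ≡ F t n) (ℕ.m+[n∸m]≡n (ℕ.≤-pred n≤T)) (sym (go n (T ∸ n)))
  where
  go : ∀ n d → F (n ℕ.+ d) n ≡ F n n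
  go n zero    = cong (λ t → F t n) (ℕ.+-identityʳ n)
  go n (suc d) = trans (cong (λ t → F t n) (ℕ.+-suc n d))
    (trans (coeff< (stable (n ℕ.+ d)) (ℕ.s≤s (ℕ.m≤m+n n d))) (go n d))

-- New factors enter on the right, in step with recurrences in the number of factors, whereas `∏` of
-- a tabulated vector splits at the front.
Π : (ℕ → Series) → ℕ → Series
Π F zero    = 1ˢ
Π F (suc J) = Π F J ⊛ F J

Π-suc : ∀ F J → Π F (suc J) ≈ F 0 ⊛ Π (λ j → F (suc j)) J
Π-suc F zero    = R.*-comm 1ˢ (F 0)
Π-suc F (suc J) = R.trans (⊛-congʳ (F (suc J)) (Π-suc F J))
  (R.*-assoc (F 0) (Π (λ j → F (suc j)) J) (F (suc J)))

∏-tabulate : ∀ F J → ∏ (Vec.tabulate {n = J} λ j → F (toℕ j)) ≈ Π F J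
∏-tabulate F zero    = R.refl
∏-tabulate F (suc J) =
  R.trans (⊛-congˡ (F 0) (∏-tabulate (λ j → F (suc j)) J)) (R.sym (Π-suc F J))

Π-⊛ : ∀ F G J → Π (λ j → F j ⊛ G j) J ≈ Π F J ⊛ Π G J
Π-⊛ F G zero    = R.sym (R.*-identityˡ 1ˢ)
Π-⊛ F G (suc J) = R.trans (⊛-congʳ (F J ⊛ G J) (Π-⊛ F G J))
  (solve 4 (λ x y z w → x :* y :* (z :* w) := x :* z :* (y :* w)) R.refl
    (Π F J) (Π G J) (F J) (G J))
  where open Solver

Π-unital : ∀ {F} → (∀ j → Unital (F j)) → ∀ J → Unital (Π F J)
Π-unital F₀ zero    = 1-unital
Π-unital F₀ (suc J) = ⊛-unital (Π-unital F₀ J) (F₀ J)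

poch-≈[] : ∀ s b .{{_ : ℕ.NonZero s}} .{{_ : ℕ.NonZero b}} T →
           [q^ s ⨾q^ b ]∞ ≈[ suc T ] Π (λ j → 1-q^ (s ℕ.+ b ℕ.* j)) T
poch-≈[] s b T = ≈[]-trans
  (below λ {n} _ → coeff (∏-tabulate factor n) n)
  (limit-≈[] stable T)
  where
  factor : ℕ → Series
  factor j = 1-q^ (s ℕ.+ b ℕ.* j)
  stable : ∀ T → Π factor (suc T) ≈[ suc T ] Π factor T
  stable T = ≈[]-trans
    -- The factor that enters at stage T is 1 - q^(s + bT), and s + bT is at least T + 1 because s
    -- and b are positive.
    (⊛-congˡ[] (Π factor T) (1-q^-≈1 _ (ℕ.+-mono-≤ (ℕ.>-nonZero⁻¹ s) (ℕ.m≤n*m T b))))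
    (≈⇒≈[] (R.*-identityʳ (Π factor T)))

poch-unital : ∀ s b .{{_ : ℕ.NonZero s}} .{{_ : ℕ.NonZero b}} → Unital [q^ s ⨾q^ b ]∞
poch-unital s b = unital (coeff< (poch-≈[] s b 0) (ℕ.s≤s ℕ.z≤n))

-- Finite sums

∑ℕ : ℕ → (ℕ → ℤ) → ℤ
∑ℕ L f = ∑[ i < L ] f (toℕ i)

∑ℕ-cong : ∀ {f g} L → (∀ i → i ℕ.< L → f i ≡ g i) → ∑ℕ L f ≡ ∑ℕ L g
∑ℕ-cong L f≡g = sum-cong-≗ {L} λ i → f≡g (toℕ i) (Fin.toℕ<n i)

∑ℕ-zero : ∀ {f} L → (∀ i → i ℕ.< L → f i ≡ 0ℤ) → ∑ℕ L f ≡ 0ℤ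
∑ℕ-zero zero    f≡0 = refl
∑ℕ-zero (suc L) f≡0 = cong₂ _+_ (f≡0 0 (ℕ.s≤s ℕ.z≤n)) (∑ℕ-zero L λ i i<L → f≡0 (suc i) (ℕ.s≤s i<L))

∑ℕ-++ : ∀ f K L → ∑ℕ (K ℕ.+ L) f ≡ ∑ℕ K f + ∑ℕ L (λ i → f (K ℕ.+ i))
∑ℕ-++ f zero    L = sym (+-identityˡ (∑ℕ L f))
∑ℕ-++ f (suc K) L = trans (cong (λ z → f 0 + z) (∑ℕ-++ (λ i → f (suc i)) K L))
  (sym (+-assoc (f 0) (∑ℕ K (λ i → f (suc i))) (∑ℕ L (λ i → f (suc K ℕ.+ i)))))

∑ℕ-last : ∀ f L → ∑ℕ (suc L) f ≡ ∑ℕ L f + f L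
∑ℕ-last f zero    = +-comm (f 0) 0ℤ
∑ℕ-last f (suc L) = trans (cong (λ z → f 0 + z) (∑ℕ-last (λ i → f (suc i)) L))
  (sym (+-assoc (f 0) (∑ℕ L (λ i → f (suc i))) (f (suc L))))

∑ℕ-evens : ∀ f L → (∀ l → f (suc (l ℕ.+ l)) ≡ 0ℤ) →
           ∑ℕ (suc (L ℕ.+ L)) f ≡ ∑ℕ (suc L) (λ l → f (l ℕ.+ l))
∑ℕ-evens f zero    odd≡0 = refl
∑ℕ-evens f (suc L) odd≡0 = begin
  ∑ℕ (suc (suc L ℕ.+ suc L)) f
    ≡⟨ ∑ℕ-last f (suc L ℕ.+ suc L) ⟩
  ∑ℕ (suc L ℕ.+ suc L) f + f (suc L ℕ.+ suc L)
    ≡⟨ cong (λ K → ∑ℕ (suc K) f + f (suc L ℕ.+ suc L)) (ℕ.+-suc L L) ⟩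
  ∑ℕ (suc (suc (L ℕ.+ L))) f + f (suc L ℕ.+ suc L)
    ≡⟨ cong (_+ f (suc L ℕ.+ suc L)) (begin
         ∑ℕ (suc (suc (L ℕ.+ L))) f
           ≡⟨ ∑ℕ-last f (suc (L ℕ.+ L)) ⟩
         ∑ℕ (suc (L ℕ.+ L)) f + f (suc (L ℕ.+ L))
           ≡⟨ cong₂ _+_ (∑ℕ-evens f L odd≡0) (odd≡0 L) ⟩
         ∑ℕ (suc L) (λ l → f (l ℕ.+ l)) + 0ℤ
           ≡⟨ +-identityʳ _ ⟩
         ∑ℕ (suc L) (λ l → f (l ℕ.+ l)) ∎) ⟩
  ∑ℕ (suc L) (λ l → f (l ℕ.+ l)) + f (suc L ℕ.+ suc L)
    ≡⟨ ∑ℕ-last (λ l → f (l ℕ.+ l)) (suc L) ⟨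
  ∑ℕ (suc (suc L)) (λ l → f (l ℕ.+ l)) ∎
  where open ≡-Reasoning

Σˢ : ℕ → (ℕ → Series) → Series
Σˢ L F n = ∑ℕ L (λ i → F i n)

Σˢ-cong : ∀ {F G} L → (∀ i → i ℕ.< L → F i ≈ G i) → Σˢ L F ≈ Σˢ L G
Σˢ-cong L F≈G = pointwise λ n → ∑ℕ-cong L λ i i<L → coeff (F≈G i i<L) n

Σˢ-zero : ∀ F → Σˢ 0 F ≈ 0ˢ
Σˢ-zero F = pointwise λ where zero → refl ; (suc n) → refl

Σˢ-head : ∀ L F → Σˢ (suc L) F ≈ F 0 ⊕ Σˢ L (λ i → F (suc i))
Σˢ-head L F = pointwise λ n → refl

Σˢ-last : ∀ L F → Σˢ (suc L) F ≈ Σˢ L F ⊕ F L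
Σˢ-last L F = pointwise λ n → ∑ℕ-last (λ i → F i n) L

Σˢ-≈0 : ∀ {F} L → (∀ i → i ℕ.< L → F i ≈[ N ] 0ˢ) → Σˢ L F ≈[ N ] 0ˢ
Σˢ-≈0 L F≈0 = below λ {n} n<N → trans
  (∑ℕ-zero L λ i i<L → trans (coeff< (F≈0 i i<L) n<N) (0ˢ≡0 n))
  (sym (0ˢ≡0 n))

Σˢ-⊕ : ∀ L F G → Σˢ L (λ i → F i ⊕ G i) ≈ Σˢ L F ⊕ Σˢ L G
Σˢ-⊕ L F G = pointwise λ n → ∑-distrib-+ {L} (λ i → F (toℕ i) n) (λ i → G (toℕ i) n)

⊛-Σˢ : ∀ L h F → h ⊛ Σˢ L F ≈ Σˢ L (λ i → h ⊛ F i)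
⊛-Σˢ zero    h F = R.trans (⊛-congˡ h (Σˢ-zero F))
  (R.trans (R.zeroʳ h) (R.sym (Σˢ-zero (λ i → h ⊛ F i))))
⊛-Σˢ (suc L) h F = R.trans (⊛-congˡ h (Σˢ-head L F))
  (R.trans (R.distribˡ h (F 0) (Σˢ L (λ i → F (suc i))))
    (R.+-cong (R.refl {h ⊛ F 0}) (⊛-Σˢ L h (λ i → F (suc i)))))

-- Elementary symmetric functions of x (s + 1) , … , x T

-- The indices are recorded as positive because the summands contain reciprocals of powers of
-- `1-q^ t`, which are meaningful only for a positive exponent.
∑<-cong : ∀ k {s T} {F G : Vec ℕ k → Series} →
          (∀ {ts} → All (1 ℕ.≤_) ts → F ts ≈ G ts) → ∑< k s T F ≈ ∑< k s T G
∑<-cong zero    F≈G = pointwise (coeff (F≈G []))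
∑<-cong (suc k) {s} {T} F≈G = pointwise λ n → sum-cong-≗ {T ∸ s} λ i →
  coeff (∑<-cong k λ ts → F≈G (ℕ.s≤s ℕ.z≤n ∷ ts)) n

∑<-⊛ : ∀ k {s T} h (F : Vec ℕ k → Series) →
       ∑< k s T (λ ts → h ⊛ F ts) ≈ h ⊛ ∑< k s T F
∑<-⊛ zero    h F = pointwise λ n → refl
∑<-⊛ (suc k) {s} {T} h F = R.trans
  (Σˢ-cong (T ∸ s) (λ i _ → ∑<-⊛ k {suc s ℕ.+ i} {T} h (λ ts → F (suc s ℕ.+ i ∷ ts))))
  (R.sym (⊛-Σˢ (T ∸ s) h (λ i → ∑< k (suc s ℕ.+ i) T (λ ts → F (suc s ℕ.+ i ∷ ts)))))

esym : (ℕ → Series) → ℕ → ℕ → ℕ → Series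
esym x k s T = ∑< k s T (λ ts → ∏ (Vec.map x ts))

module _ (x : ℕ → Series) where

  esym-head : ∀ k s T → esym x (suc k) s T ≈
              Σˢ (T ∸ s) (λ i → x (suc s ℕ.+ i) ⊛ esym x k (suc s ℕ.+ i) T)
  esym-head k s T = Σˢ-cong (T ∸ s) λ i _ → ∑<-⊛ k {suc s ℕ.+ i} {T} (x (suc s ℕ.+ i)) (λ ts → ∏ (Vec.map x ts))

  -- The nested sum splits off the smallest variable; the leading terms require splitting off the
  -- largest. Keeping the lower end `s` general lets the induction on k apply to the inner sums,
  -- which start at the chosen smallest index.
  esym-last : ∀ k {s T} → s ℕ.≤ T →
              esym x (suc k) s (suc T) ≈ esym x (suc k) s T ⊕ x (suc T) ⊛ esym x k s T
  esym-last k {s} {T} s≤T = begin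
    esym x (suc k) s (suc T)
      ≈⟨ esym-head k s (suc T) ⟩
    Σˢ (suc T ∸ s) (summand (suc T))
      ≡⟨ cong (λ L → Σˢ L (summand (suc T))) (ℕ.+-∸-assoc 1 s≤T) ⟩
    Σˢ (suc (T ∸ s)) (summand (suc T))
      ≈⟨ Σˢ-last (T ∸ s) (summand (suc T)) ⟩
    Σˢ (T ∸ s) (summand (suc T)) ⊕ summand (suc T) (T ∸ s)
      ≡⟨ cong (λ t → Σˢ (T ∸ s) (summand (suc T)) ⊕ x t ⊛ esym x k t (suc T))
              (cong suc (ℕ.m+[n∸m]≡n s≤T)) ⟩
    Σˢ (T ∸ s) (summand (suc T)) ⊕ x (suc T) ⊛ esym x k (suc T) (suc T)
      ≈⟨ split k ⟩
    Σˢ (T ∸ s) (summand T) ⊕ x (suc T) ⊛ esym x k s T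
      ≈⟨ R.+-cong (esym-head k s T) (R.refl {x (suc T) ⊛ esym x k s T}) ⟨
    esym x (suc k) s T ⊕ x (suc T) ⊛ esym x k s T ∎
    where
    open ≈-Reasoning
    open Solver

    summand′ : ℕ → ℕ → ℕ → Series
    summand′ k T i = x (suc s ℕ.+ i) ⊛ esym x k (suc s ℕ.+ i) T

    summand : ℕ → ℕ → Series
    summand = summand′ k

    split : ∀ k → Σˢ (T ∸ s) (summand′ k (suc T)) ⊕ x (suc T) ⊛ esym x k (suc T) (suc T) ≈
                  Σˢ (T ∸ s) (summand′ k T) ⊕ x (suc T) ⊛ esym x k s T
    split zero    = pointwise λ n → refl
    -- If T + 1 is the smallest index, no larger one is left for the remaining k + 1 variables, so
    -- the extra summand is zero. In the case `zero` it is the whole new contribution.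
    split (suc k) = begin
      Σˢ (T ∸ s) (summand′ (suc k) (suc T)) ⊕ x (suc T) ⊛ esym x (suc k) (suc T) (suc T)
        ≈⟨ R.+-cong (Σˢ-cong (T ∸ s) step) (⊛-congˡ (x (suc T)) empty) ⟩
      Σˢ (T ∸ s) (λ i → summand′ (suc k) T i ⊕ x (suc T) ⊛ summand′ k T i) ⊕ x (suc T) ⊛ 0ˢ
        ≈⟨ R.+-cong (Σˢ-⊕ (T ∸ s) (summand′ (suc k) T) (λ i → x (suc T) ⊛ summand′ k T i))
                    (R.refl {x (suc T) ⊛ 0ˢ}) ⟩
      Σˢ (T ∸ s) (summand′ (suc k) T) ⊕ Σˢ (T ∸ s) (λ i → x (suc T) ⊛ summand′ k T i) ⊕ x (suc T) ⊛ 0ˢ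
        ≈⟨ R.+-cong (R.+-cong (R.refl {Σˢ (T ∸ s) (summand′ (suc k) T)})
                      (R.trans (⊛-congˡ (x (suc T)) (esym-head k s T)) (⊛-Σˢ (T ∸ s) (x (suc T)) (summand′ k T))))
                    (R.refl {x (suc T) ⊛ 0ˢ}) ⟨
      Σˢ (T ∸ s) (summand′ (suc k) T) ⊕ x (suc T) ⊛ esym x (suc k) s T ⊕ x (suc T) ⊛ 0ˢ
        ≈⟨ solve 3 (λ u v w → u :+ v :* w :+ v :* con 0ℤ := u :+ v :* w) R.refl
             (Σˢ (T ∸ s) (summand′ (suc k) T)) (x (suc T)) (esym x (suc k) s T) ⟩
      Σˢ (T ∸ s) (summand′ (suc k) T) ⊕ x (suc T) ⊛ esym x (suc k) s T ∎
      where
      empty : esym x (suc k) (suc T) (suc T) ≈ 0ˢ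
      empty = R.trans (esym-head k (suc T) (suc T)) (R.trans
        (R.reflexive (cong (λ L → Σˢ L F) (ℕ.n∸n≡0 (suc T)))) (Σˢ-zero F))
        where
        F : ℕ → Series
        F i = x (suc (suc T) ℕ.+ i) ⊛ esym x k (suc (suc T) ℕ.+ i) (suc T)

      step : ∀ i → i ℕ.< T ∸ s → summand′ (suc k) (suc T) i ≈
             summand′ (suc k) T i ⊕ x (suc T) ⊛ summand′ k T i
      step i i<T∸s = R.trans
        (⊛-congˡ (x t) (esym-last k t≤T))
        (solve 4 (λ u v w z → u :* (v :+ w :* z) := u :* v :+ w :* (u :* z)) R.refl
          (x t) (esym x (suc k) t T) (x (suc T)) (esym x k t T))
        where
        t = suc s ℕ.+ i
        t≤T : t ℕ.≤ T
        t≤T = ℕ.≤-trans (ℕ.≤-reflexive (sym (ℕ.+-suc s i)))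
          (ℕ.≤-trans (ℕ.+-monoʳ-≤ s i<T∸s) (ℕ.≤-reflexive (ℕ.m+[n∸m]≡n s≤T)))

  esym-≈0 : ∀ k T → T ℕ.< k → esym x k 0 T ≈ 0ˢ
  esym-≈0 (suc k) zero    _   = pointwise (coeff (Σˢ-zero λ _ → 0ˢ))
  esym-≈0 (suc k) (suc T) T<k = R.trans (esym-last k ℕ.z≤n) (R.trans
    (R.+-cong (esym-≈0 (suc k) T (ℕ.<-trans (ℕ.n<1+n T) T<k))
              (R.trans (⊛-congˡ (x (suc T)) (esym-≈0 k T (ℕ.s<s⁻¹ T<k))) (R.zeroʳ (x (suc T)))))
    (R.+-identityˡ 0ˢ))

-- The leading behaviour of A k (b = 1) and C k (b = 2)

lead : ℕ → ℕ → ℕ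
lead b zero    = 0
lead b (suc k) = lead b k ℕ.+ suc (b ℕ.* k)

^ˢ-cong[] : ∀ k → f ≈[ N ] g → f ^ˢ k ≈[ N ] g ^ˢ k
^ˢ-cong[] zero    p = ≈[]-refl
^ˢ-cong[] (suc k) p = ⊛-cong[] p (^ˢ-cong[] k p)

Π-^ˢ : ∀ F k J → Π (λ j → F j ^ˢ k) J ≈ Π F J ^ˢ k
Π-^ˢ F zero    zero    = R.refl
Π-^ˢ F zero    (suc J) = R.trans (R.*-identityʳ _) (Π-^ˢ F zero J)
Π-^ˢ F (suc k) J = R.trans (Π-⊛ F (λ j → F j ^ˢ k) J) (⊛-congˡ (Π F J) (Π-^ˢ F k J))

-- The exponents `u j` are 1, 2, 3, ... for b = 1 and 1, 3, 5, ... for b = 2, and `lead b k` is the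
-- sum of the first k of them. The products of `squared` and `factor` tend to (q;q^b)_∞² and
-- (q^b;q^b)_∞.
module Leading (b : ℕ) .{{b≢0 : ℕ.NonZero b}} where

  u : ℕ → ℕ
  u j = suc (b ℕ.* j)

  u-mono : ∀ {i j} → i ℕ.≤ j → u i ℕ.≤ u j
  u-mono i≤j = ℕ.s≤s (ℕ.*-monoʳ-≤ b i≤j)

  T<u[T] : ∀ T → T ℕ.< u T
  T<u[T] T = ℕ.s≤s (ℕ.m≤n*m T b)

  squared factor : ℕ → Series
  squared j = 1-q^ (u j) ^ˢ 2
  factor j = 1-q^ (b ℕ.+ b ℕ.* j)

  squared-unital : ∀ j → Unital (squared j)
  squared-unital j = ^ˢ-unital 2 (1-q^-unital (u j))

  squared-≈1 : ∀ j → N ℕ.≤ u j → squared j ≈[ N ] 1ˢ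
  squared-≈1 {N} j N≤u = ≈[]-trans (^ˢ-cong[] 2 (1-q^-≈1 (u j) N≤u))
    (≈⇒≈[] (R.trans (R.*-identityˡ (1ˢ ⊛ 1ˢ)) (R.*-identityˡ 1ˢ)))

  module _ (x : ℕ → Series) (x-suc : ∀ j → x (suc j) ≈ q^ (u j) ⊘ squared j) where

    -- All T denominators are cleared, including those absent from a given monomial; this makes the
    -- recurrence in T free of reciprocals.
    cleared : ℕ → ℕ → Series
    cleared k T = esym x k 0 T ⊛ Π squared T

    cleared-suc : ∀ k T → cleared (suc k) (suc T) ≈
                  squared T ⊛ cleared (suc k) T ⊕ q^ (u T) ⊛ cleared k T
    cleared-suc k T = begin
      esym x (suc k) 0 (suc T) ⊛ (P ⊛ D)
        ≈⟨ ⊛-congʳ (P ⊛ D) (esym-last x k ℕ.z≤n) ⟩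
      (e′ ⊕ x (suc T) ⊛ e) ⊛ (P ⊛ D)
        ≈⟨ ⊛-congʳ (P ⊛ D) (R.+-cong (R.refl {e′}) (⊛-congʳ e (x-suc T))) ⟩
      (e′ ⊕ q^ (u T) ⊛ recip D ⊛ e) ⊛ (P ⊛ D)
        ≈⟨ solve 6 (λ e′ Q r e P D → (e′ :+ Q :* r :* e) :* (P :* D) :=
              D :* (e′ :* P) :+ Q :* (e :* P) :* (D :* r)) R.refl
             e′ (q^ (u T)) (recip D) e P D ⟩
      D ⊛ (e′ ⊛ P) ⊕ q^ (u T) ⊛ (e ⊛ P) ⊛ (D ⊛ recip D)
        ≈⟨ R.+-cong (R.refl {D ⊛ (e′ ⊛ P)}) (R.trans
             (⊛-congˡ (q^ (u T) ⊛ (e ⊛ P)) (⊛-inverseʳ (squared-unital T)))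
             (R.*-identityʳ (q^ (u T) ⊛ (e ⊛ P)))) ⟩
      D ⊛ (e′ ⊛ P) ⊕ q^ (u T) ⊛ (e ⊛ P) ∎
      where
      open ≈-Reasoning
      open Solver
      P = Π squared T
      D = squared T
      e = esym x k 0 T
      e′ = esym x (suc k) 0 T

    -- With as many variables as the degree there is a single monomial, and its denominators cancel
    -- exactly.
    cleared-diagonal : ∀ k → cleared k k ≈ q^ (lead b k)
    cleared-diagonal zero    = R.*-identityˡ 1ˢ
    cleared-diagonal (suc k) = begin
      cleared (suc k) (suc k)
        ≈⟨ cleared-suc k k ⟩
      squared k ⊛ (esym x (suc k) 0 k ⊛ Π squared k) ⊕ q^ (u k) ⊛ cleared k k
        ≈⟨ R.+-cong (⊛-congˡ (squared k) (⊛-congʳ (Π squared k) (esym-≈0 x (suc k) k ℕ.≤-refl)))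
                    (⊛-congˡ (q^ (u k)) (cleared-diagonal k)) ⟩
      squared k ⊛ (0ˢ ⊛ Π squared k) ⊕ q^ (u k) ⊛ q^ (lead b k)
        ≈⟨ solve 4 (λ x y z w → x :* (con 0ℤ :* y) :+ z :* w := w :* z) R.refl
             (squared k) (Π squared k) (q^ (u k)) (q^ (lead b k)) ⟩
      q^ (lead b k) ⊛ q^ (u k)
        ≈⟨ q^-+ (lead b k) (u k) ⟩
      q^ (lead b (suc k)) ∎
      where
      open ≈-Reasoning
      open Solver

    -- After division by the leading power, cleared k (i + k) tends for k → ∞ to
    -- some h i with h i = h (i - 1) + q^(b i) h i, that is, 1/(q^b ; q^b)_i.
    cleared-leading : ∀ k i → cleared k (i ℕ.+ k) ⊛ Π factor i ≈[ lead b k ℕ.+ u k ] q^ (lead b k)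
    -- For k = 0 the modulus is q^1, so only the constant term is in question.
    cleared-leading zero i = below λ n<u → constant-term (ℕ.≤-trans n<u (ℕ.≤-reflexive (cong suc (ℕ.*-zeroʳ b))))
      where
      constant-term : n ℕ.< 1 → (cleared 0 (i ℕ.+ 0) ⊛ Π factor i) n ≡ 1ˢ n
      constant-term {zero} _ = Unital.constantTerm (⊛-unital
        (⊛-unital 1-unital (Π-unital squared-unital (i ℕ.+ 0)))
        (Π-unital (λ j → 1-q^-unital (b ℕ.+ b ℕ.* j) {{ℕ.>-nonZero (ℕ.≤-trans (ℕ.>-nonZero⁻¹ b) (ℕ.m≤m+n b _))}}) i))
      constant-term {suc n} (ℕ.s≤s ())
    cleared-leading (suc k) zero =
      ≈⇒≈[] (R.trans (R.*-identityʳ (cleared (suc k) (suc k))) (cleared-diagonal (suc k)))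
    cleared-leading (suc k) (suc i) = begin
      cleared (suc k) (suc (i ℕ.+ suc k)) ⊛ (Π factor i ⊛ factor i)
        ≈⟨ ≈⇒≈[] (⊛-congʳ (Π factor i ⊛ factor i) (cleared-suc k t)) ⟩
      (squared t ⊛ cleared (suc k) t ⊕ q^ (u t) ⊛ cleared k t) ⊛ (Π factor i ⊛ factor i)
        ≈⟨ ≈⇒≈[] (solve 6 (λ D c Q c′ P F → (D :* c :+ Q :* c′) :* (P :* F) :=
             D :* (F :* (c :* P)) :+ Q :* (c′ :* (P :* F))) R.refl
             (squared t) (cleared (suc k) t) (q^ (u t)) (cleared k t) (Π factor i) (factor i)) ⟩
      squared t ⊛ (factor i ⊛ (cleared (suc k) t ⊛ Π factor i)) ⊕
      q^ (u t) ⊛ (cleared k t ⊛ Π factor (suc i))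
        ≈⟨ ⊕-cong[] first second ⟩
      q^ E ⊛ factor i ⊕ q^ E ⊛ q^ (b ℕ.+ b ℕ.* i)
        ≈⟨ ≈⇒≈[] (R.+-cong (⊛-congˡ (q^ E) (1-q^-def (b ℕ.+ b ℕ.* i)))
                           (R.refl {q^ E ⊛ q^ (b ℕ.+ b ℕ.* i)})) ⟩
      q^ E ⊛ (constant 1ℤ ⊕ ⊝ q^ (b ℕ.+ b ℕ.* i)) ⊕ q^ E ⊛ q^ (b ℕ.+ b ℕ.* i)
        ≈⟨ ≈⇒≈[] (solve 2 (λ x y → x :* (con 1ℤ :+ :- y) :+ x :* y := x) R.refl
             (q^ E) (q^ (b ℕ.+ b ℕ.* i))) ⟩
      q^ E ∎
      where
      t = i ℕ.+ suc k
      E = lead b (suc k)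
      M = E ℕ.+ u (suc k)
      open ≈[]-Reasoning M
      open Solver

      u[1+k]≤u[t] : u (suc k) ℕ.≤ u t
      u[1+k]≤u[t] = u-mono (ℕ.m≤n+m (suc k) i)

      -- `squared t` differs from 1 only from q^(u t) on; once q^E is in front, that difference lies
      -- beyond M because `u t` is at least `u (suc k)`.
      first : squared t ⊛ (factor i ⊛ (cleared (suc k) t ⊛ Π factor i)) ≈[ M ] q^ E ⊛ factor i
      first = begin
        squared t ⊛ (factor i ⊛ (cleared (suc k) t ⊛ Π factor i))
          ≈⟨ ⊛-congˡ[] (squared t) (⊛-congˡ[] (factor i) (cleared-leading (suc k) i)) ⟩
        squared t ⊛ (factor i ⊛ q^ E)
          ≈⟨ ≈⇒≈[] (solve 3 (λ x y z → x :* (y :* z) := z :* (x :* y)) R.refl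
               (squared t) (factor i) (q^ E)) ⟩
        q^ E ⊛ (squared t ⊛ factor i)
          ≈⟨ q^-⊛-cong[] E (⊛-congʳ[] (factor i) (squared-≈1 t u[1+k]≤u[t])) ⟩
        q^ E ⊛ (1ˢ ⊛ factor i)
          ≈⟨ ⊛-congˡ[] (q^ E) (≈⇒≈[] (R.*-identityˡ (factor i))) ⟩
        q^ E ⊛ factor i ∎

      exponent : ∀ b i k l → suc (b ℕ.* (i ℕ.+ suc k)) ℕ.+ l ≡
                             l ℕ.+ suc (b ℕ.* k) ℕ.+ (b ℕ.+ b ℕ.* i)
      exponent = ℕ.solve-∀

      -- The hypothesis for k and i + 1 has precision `lead b k ℕ.+ u k`, which is E; the factor
      -- q^(u t) raises it to `u t ℕ.+ E`, at least M. The resulting power is the one that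
      -- `factor i` takes away in `first`.
      second : q^ (u t) ⊛ (cleared k t ⊛ Π factor (suc i)) ≈[ M ] q^ E ⊛ q^ (b ℕ.+ b ℕ.* i)
      second = begin
        q^ (u t) ⊛ (cleared k t ⊛ Π factor (suc i))
          ≡⟨ cong (λ j → q^ (u t) ⊛ (cleared k j ⊛ Π factor (suc i))) (ℕ.+-suc i k) ⟩
        q^ (u t) ⊛ (cleared k (suc i ℕ.+ k) ⊛ Π factor (suc i))
          ≈⟨ ≈[]-weaken (ℕ.≤-trans (ℕ.≤-reflexive (ℕ.+-comm E (u (suc k)))) (ℕ.+-monoˡ-≤ E u[1+k]≤u[t]))
               (q^-⊛-cong[] (u t) (cleared-leading k (suc i))) ⟩
        q^ (u t) ⊛ q^ (lead b k)
          ≈⟨ ≈⇒≈[] (q^-+ (u t) (lead b k)) ⟩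
        q^ (u t ℕ.+ lead b k)
          ≡⟨ cong q^ (exponent b i k (lead b k)) ⟩
        q^ (E ℕ.+ (b ℕ.+ b ℕ.* i))
          ≈⟨ ≈⇒≈[] (q^-+ E (b ℕ.+ b ℕ.* i)) ⟨
        q^ E ⊛ q^ (b ℕ.+ b ℕ.* i) ∎

    -- The variable that enters is divisible by q^(u T), and `u T` exceeds T. This is what gives
    -- `limit` its meaning here.
    esym-stable : ∀ k T → esym x k 0 (suc T) ≈[ suc T ] esym x k 0 T
    esym-stable zero    T = ≈[]-refl
    esym-stable (suc k) T = begin
      esym x (suc k) 0 (suc T)
        ≈⟨ ≈⇒≈[] (esym-last x k ℕ.z≤n) ⟩
      e′ ⊕ x (suc T) ⊛ e
        ≈⟨ ⊕-cong[] (≈[]-refl {x = e′}) (begin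
             x (suc T) ⊛ e
               ≈⟨ ≈⇒≈[] (⊛-congʳ e (x-suc T)) ⟩
             q^ (u T) ⊛ recip (squared T) ⊛ e
               ≈⟨ ≈⇒≈[] (R.*-assoc (q^ (u T)) (recip (squared T)) e) ⟩
             q^ (u T) ⊛ (recip (squared T) ⊛ e)
               ≈⟨ q^-⊛-≈0 (u T) (recip (squared T) ⊛ e) (T<u[T] T) ⟩
             0ˢ ∎) ⟩
      e′ ⊕ 0ˢ
        ≈⟨ ≈⇒≈[] (R.+-identityʳ e′) ⟩
      e′ ∎
      where
      open ≈[]-Reasoning (suc T)
      e = esym x k 0 T
      e′ = esym x (suc k) 0 T

    leading : ∀ k → limit (esym x k 0) ⊛ [q^ 1 ⨾q^ b ]∞ ^ˢ 2 ⊛ [q^ b ⨾q^ b ]∞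
                    ≈[ lead b k ℕ.+ u k ] q^ (lead b k)
    leading k = begin
      limit (esym x k 0) ⊛ [q^ 1 ⨾q^ b ]∞ ^ˢ 2 ⊛ [q^ b ⨾q^ b ]∞
        ≈⟨ ⊛-cong[] (⊛-cong[]
             (≈[]-weaken i≤T (limit-≈[] (esym-stable k) T))
             (≈[]-weaken i≤T (≈[]-trans (^ˢ-cong[] 2 (poch-≈[] 1 b T))
               (≈⇒≈[] (R.sym (Π-^ˢ (λ j → 1-q^ (u j)) 2 T))))))
             (≈[]-weaken (ℕ.n≤1+n i) (poch-≈[] b b i)) ⟩
      cleared k T ⊛ Π factor i
        ≈⟨ cleared-leading k i ⟩
      q^ (lead b k) ∎
      where
      -- Taking the required precision itself as the number of factors makes all three truncations
      -- accurate to q^i, and T = i + k is the shape that `cleared-leading` treats.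
      i = lead b k ℕ.+ u k
      T = i ℕ.+ k
      open ≈[]-Reasoning i
      i≤T : i ℕ.≤ suc T
      i≤T = ℕ.m≤n⇒m≤1+n (ℕ.m≤m+n i k)

-- The summands of `A k` and `C k` as products of fractions

module Fractions (b : ℕ) .{{b≢0 : ℕ.NonZero b}}
                 (w : ℕ → ℕ) (w-suc : ∀ j → w (suc j) ≡ suc (b ℕ.* j)) where

  open Leading b

  denominator fraction : ℕ → Series
  denominator t = 1-q^ (w t) ^ˢ 2
  fraction t = q^ (w t) ⊘ denominator t

  fraction-suc : ∀ j → fraction (suc j) ≈ q^ (u j) ⊘ squared j
  fraction-suc j = R.reflexive (cong (λ e → q^ e ⊘ 1-q^ e ^ˢ 2) (w-suc j))

  denominator-unital : ∀ {t} → 1 ℕ.≤ t → Unital (denominator t)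
  denominator-unital {suc j} _ =
    ^ˢ-unital 2 (subst (λ e → Unital (1-q^ e)) (sym (w-suc j)) (1-q^-unital (u j)))

  denominators-unital : ∀ {k} {ts : Vec ℕ k} → All (1 ℕ.≤_) ts →
                        Unital (∏ (Vec.map denominator ts))
  denominators-unital []       = 1-unital
  denominators-unital (p ∷ ps) = ⊛-unital (denominator-unital p) (denominators-unital ps)

  ∏-fraction : ∀ {k} {ts : Vec ℕ k} → All (1 ℕ.≤_) ts →
               q^ (Vec.sum (Vec.map w ts)) ⊘ ∏ (Vec.map denominator ts) ≈
               ∏ (Vec.map fraction ts)
  ∏-fraction [] = ⊛-inverseʳ 1-unital
  ∏-fraction {ts = t ∷ ts} (p ∷ ps) = begin
    q^ (w t ℕ.+ W) ⊛ recip (denominator t ⊛ D)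
      ≈⟨ R.*-cong (R.sym (q^-+ (w t) W))
                  (recip-⊛ (denominator-unital p) (denominators-unital ps)) ⟩
    (q^ (w t) ⊛ q^ W) ⊛ (recip (denominator t) ⊛ recip D)
      ≈⟨ solve 4 (λ x y z w → x :* y :* (z :* w) := x :* z :* (y :* w)) R.refl
           (q^ (w t)) (q^ W) (recip (denominator t)) (recip D) ⟩
    fraction t ⊛ (q^ W ⊘ D)
      ≈⟨ ⊛-congˡ (fraction t) (∏-fraction ps) ⟩
    fraction t ⊛ ∏ (Vec.map fraction ts) ∎
    where
    open ≈-Reasoning
    open Solver
    W = Vec.sum (Vec.map w ts)
    D = ∏ (Vec.map denominator ts)

  -- `F` stays abstract because `A k` and `C k` write the exponent differently, one as a plain sum
  -- and the other as a truncated difference.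
  leading-limit : ∀ k (F : Vec ℕ k → Series) →
    (∀ {ts} → All (1 ℕ.≤_) ts →
      F ts ≈ q^ (Vec.sum (Vec.map w ts)) ⊘ ∏ (Vec.map denominator ts)) →
    limit (λ T → ∑< k 0 T F) ⊛ [q^ 1 ⨾q^ b ]∞ ^ˢ 2 ⊛ [q^ b ⨾q^ b ]∞
      ≈[ lead b k ℕ.+ u k ] q^ (lead b k)
  leading-limit k F F≈ = ≈[]-trans
    (≈⇒≈[] (⊛-congʳ [q^ b ⨾q^ b ]∞ (⊛-congʳ ([q^ 1 ⨾q^ b ]∞ ^ˢ 2)
      (pointwise λ n → coeff (∑<-cong k {0} {n} (λ ps → R.trans (F≈ ps) (∏-fraction ps))) n))))
    (leading fraction fraction-suc k)

A-leading : ∀ k → A k ⊛ [q^ 1 ⨾q^ 1 ]∞ ^ˢ 2 ⊛ [q^ 1 ⨾q^ 1 ]∞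
                  ≈[ lead 1 k ℕ.+ Leading.u 1 k ] q^ (lead 1 k)
A-leading k = leading-limit k _ λ {ts} _ →
  R.reflexive (cong (λ us → q^ (Vec.sum us) ⊘ ∏ (Vec.map denominator ts)) (sym (map-id ts)))
  where open Fractions 1 (λ t → t) (λ j → cong suc (sym (ℕ.*-identityˡ j)))

C-leading : ∀ k → C k ⊛ [q^ 1 ⨾q^ 2 ]∞ ^ˢ 2 ⊛ [q^ 2 ⨾q^ 2 ]∞
                  ≈[ lead 2 k ℕ.+ Leading.u 2 k ] q^ (lead 2 k)
C-leading k = leading-limit k _ λ {ts} ps →
  R.reflexive (cong (λ e → q^ e ⊘ ∏ (Vec.map denominator ts)) (proj₂ (exponent ps)))
  where
  open Fractions 2 (λ t → 2 ℕ.* t ∸ 1) (λ j → ℕ.+-suc j (j ℕ.+ 0))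

  -- The inequality is carried along so that the truncated subtraction of k can be distributed over
  -- the entries.
  exponent : ∀ {k} {ts : Vec ℕ k} → All (1 ℕ.≤_) ts →
             k ℕ.≤ Vec.sum (Vec.map (2 ℕ.*_) ts) ×
             Vec.sum (Vec.map (2 ℕ.*_) ts) ∸ k ≡ Vec.sum (Vec.map (λ t → 2 ℕ.* t ∸ 1) ts)
  exponent [] = ℕ.z≤n , refl
  exponent {suc k} {suc j ∷ ts} (_ ∷ ps) with exponent ps
  ... | k≤S , S∸k≡ = ℕ.s≤s (ℕ.≤-trans k≤S (ℕ.m≤n+m S (j ℕ.+ suc (j ℕ.+ 0)))) ,
        trans (ℕ.+-∸-assoc (j ℕ.+ suc (j ℕ.+ 0)) k≤S) (cong (j ℕ.+ suc (j ℕ.+ 0) ℕ.+_) S∸k≡)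
    where S = Vec.sum (Vec.map (2 ℕ.*_) ts)

-- Shanks' proof of the pentagonal number theorem

-- Twice the generalized pentagonal number of s, by cases on the sign so that the exponent is
-- visibly natural.
pent : ℤ → ℕ
pent (+ n)    = n ℕ.* (3 ℕ.* n ℕ.+ 1)
pent -[1+ n ] = suc n ℕ.* (3 ℕ.* n ℕ.+ 2)

signed : ℕ → Series
signed s = constant (-1ℤ ^ s)

pentTerm : ℤ → Series
pentTerm s = signed ∣ s ∣ ⊛ q^ (pent s)

pentSum : ℕ → Series
pentSum n = Σˢ (suc (n ℕ.+ n)) (λ l → pentTerm (+ l - + n))

signed-suc : ∀ s → signed (suc s) ≈ ⊝ signed s
signed-suc s = pointwise λ where
  zero    → -1*i≡-i (-1ℤ ^ s)
  (suc n) → refl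

module Shanks where

  factor : ℕ → Series
  factor j = 1-q^ (2 ℕ.+ 2 ℕ.* j)

  factorial : ℕ → Series
  factorial = Π factor

  factorial-unital : ∀ n → Unital (factorial n)
  factorial-unital = Π-unital λ j → 1-q^-unital (2 ℕ.+ 2 ℕ.* j)

  recip-factorial : ∀ n → recip (factorial n) ≈ recip (factorial (suc n)) ⊛ factor n
  recip-factorial n = begin
    recip (factorial n)
      ≈⟨ R.*-identityʳ (recip (factorial n)) ⟨
    recip (factorial n) ⊛ 1ˢ
      ≈⟨ ⊛-congˡ (recip (factorial n)) (⊛-inverseʳ factor-unital) ⟨
    recip (factorial n) ⊛ (factor n ⊛ recip (factor n))
      ≈⟨ solve 3 (λ x y z → x :* (y :* z) := x :* z :* y) R.refl
           (recip (factorial n)) (factor n) (recip (factor n)) ⟩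
    recip (factorial n) ⊛ recip (factor n) ⊛ factor n
      ≈⟨ ⊛-congʳ (factor n) (recip-⊛ (factorial-unital n) factor-unital) ⟨
    recip (factorial (suc n)) ⊛ factor n ∎
    where
    open ≈-Reasoning
    open Solver
    factor-unital : Unital (factor n)
    factor-unital = 1-q^-unital (2 ℕ.+ 2 ℕ.* n)

  expo : ℕ → ℕ → ℕ
  expo n s = 2 ℕ.* (s ℕ.* n) ℕ.+ s ℕ.* (s ℕ.+ 1)

  ratio : ℕ → ℕ → Series
  ratio n s = signed s ⊛ (factorial n ⊛ recip (factorial s))

  term : ℕ → ℕ → Series
  term n s = ratio n s ⊛ q^ (expo n s)

  -- term (suc n) s - term n s = certificate n s - certificate n (s - 1)
  certificate : ℕ → ℕ → Series
  certificate n s = ⊝ (ratio n s ⊛ q^ (expo (suc n) s ℕ.+ (2 ℕ.+ 2 ℕ.* n)))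

  term-suc : ∀ n s → term (suc n) s ≈ ratio n s ⊛ q^ (expo (suc n) s) ⊕ certificate n s
  term-suc n s = begin
    signed s ⊛ (factorial n ⊛ factor n ⊛ r) ⊛ X
      ≈⟨ ⊛-congʳ X (⊛-congˡ (signed s) (⊛-congʳ r (⊛-congˡ (factorial n)
           (1-q^-def (2 ℕ.+ 2 ℕ.* n))))) ⟩
    signed s ⊛ (factorial n ⊛ (constant 1ℤ ⊕ ⊝ y) ⊛ r) ⊛ X
      ≈⟨ solve 5 (λ ε Q y r X → ε :* (Q :* (con 1ℤ :+ :- y) :* r) :* X :=
            ε :* (Q :* r) :* X :+ :- (ε :* (Q :* r) :* (X :* y))) R.refl
           (signed s) (factorial n) y r X ⟩
    ratio n s ⊛ X ⊕ ⊝ (ratio n s ⊛ (X ⊛ y))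
      ≈⟨ R.+-cong (R.refl {ratio n s ⊛ X}) (R.-‿cong (⊛-congˡ (ratio n s)
           (q^-+ (expo (suc n) s) (2 ℕ.+ 2 ℕ.* n)))) ⟩
    ratio n s ⊛ X ⊕ certificate n s ∎
    where
    open ≈-Reasoning
    open Solver
    y = q^ (2 ℕ.+ 2 ℕ.* n)
    r = recip (factorial s)
    X = q^ (expo (suc n) s)

  -- Over the common denominator `factorial (suc s)`, both summands contain q^(`expo n (suc s)`);
  -- the parts with a further q^(2s + 2) cancel.
  certificate-step : ∀ n s →
    certificate n s ⊕ ratio n (suc s) ⊛ q^ (expo (suc n) (suc s)) ≈ term n (suc s)
  certificate-step n s = begin
    ⊝ (ratio n s ⊛ q^ (expo (suc n) s ℕ.+ (2 ℕ.+ 2 ℕ.* n))) ⊕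
      ratio n (suc s) ⊛ q^ (expo (suc n) (suc s))
      ≡⟨ cong₂ (λ d e → ⊝ (ratio n s ⊛ q^ d) ⊕ ratio n (suc s) ⊛ q^ e)
           (exponent₁ n s) (exponent₂ n s) ⟩
    ⊝ (ratio n s ⊛ X) ⊕ ratio n (suc s) ⊛ q^ (expo n (suc s) ℕ.+ (2 ℕ.+ 2 ℕ.* s))
      ≈⟨ R.+-cong
           (R.-‿cong (⊛-congʳ X (⊛-congˡ (signed s) (⊛-congˡ Q
             (R.trans (recip-factorial s) (⊛-congˡ r (1-q^-def (2 ℕ.+ 2 ℕ.* s))))))))
           (R.*-cong (⊛-congʳ (Q ⊛ r) (signed-suc s))
             (R.sym (q^-+ (expo n (suc s)) (2 ℕ.+ 2 ℕ.* s)))) ⟩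
    ⊝ (signed s ⊛ (Q ⊛ (r ⊛ (constant 1ℤ ⊕ ⊝ x))) ⊛ X) ⊕ ⊝ signed s ⊛ (Q ⊛ r) ⊛ (X ⊛ x)
      ≈⟨ solve 5 (λ ε Q r x X →
           :- (ε :* (Q :* (r :* (con 1ℤ :+ :- x))) :* X) :+ :- ε :* (Q :* r) :* (X :* x) :=
           :- ε :* (Q :* r) :* X) R.refl (signed s) Q r x X ⟩
    ⊝ signed s ⊛ (Q ⊛ r) ⊛ X
      ≈⟨ ⊛-congʳ X (⊛-congʳ (Q ⊛ r) (signed-suc s)) ⟨
    term n (suc s) ∎
    where
    open ≈-Reasoning
    open Solver
    Q = factorial n
    r = recip (factorial (suc s))
    x = q^ (2 ℕ.+ 2 ℕ.* s)
    X = q^ (expo n (suc s))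
    exponent₁ : ∀ n s → 2 ℕ.* (s ℕ.* suc n) ℕ.+ s ℕ.* (s ℕ.+ 1) ℕ.+ (2 ℕ.+ 2 ℕ.* n) ≡
                        2 ℕ.* (suc s ℕ.* n) ℕ.+ suc s ℕ.* (suc s ℕ.+ 1)
    exponent₁ = ℕ.solve-∀
    exponent₂ : ∀ n s → 2 ℕ.* (suc s ℕ.* suc n) ℕ.+ suc s ℕ.* (suc s ℕ.+ 1) ≡
                        2 ℕ.* (suc s ℕ.* n) ℕ.+ suc s ℕ.* (suc s ℕ.+ 1) ℕ.+ (2 ℕ.+ 2 ℕ.* s)
    exponent₂ = ℕ.solve-∀

  telescope : ∀ n j → Σˢ (suc j) (term (suc n)) ≈ Σˢ (suc j) (term n) ⊕ certificate n j
  telescope n zero = begin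
    Σˢ 1 (term (suc n))
      ≈⟨ Σˢ-last 0 (term (suc n)) ⟩
    Σˢ 0 (term (suc n)) ⊕ term (suc n) 0
      -- Both `expo (suc n) 0` and `expo n 0` compute to 0, so at s = 0 no preceding certificate is
      -- involved.
      ≈⟨ R.+-cong (R.trans (Σˢ-zero (term (suc n))) (R.sym (Σˢ-zero (term n)))) (term-suc n 0) ⟩
    Σˢ 0 (term n) ⊕ (term n 0 ⊕ certificate n 0)
      ≈⟨ R.+-assoc (Σˢ 0 (term n)) (term n 0) (certificate n 0) ⟨
    Σˢ 0 (term n) ⊕ term n 0 ⊕ certificate n 0
      ≈⟨ R.+-cong (Σˢ-last 0 (term n)) (R.refl {certificate n 0}) ⟨
    Σˢ 1 (term n) ⊕ certificate n 0 ∎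
    where open ≈-Reasoning
  telescope n (suc j) = begin
    Σˢ (suc (suc j)) (term (suc n))
      ≈⟨ Σˢ-last (suc j) (term (suc n)) ⟩
    Σˢ (suc j) (term (suc n)) ⊕ term (suc n) (suc j)
      ≈⟨ R.+-cong (telescope n j) (term-suc n (suc j)) ⟩
    (S ⊕ certificate n j) ⊕ (ratio n (suc j) ⊛ X ⊕ certificate n (suc j))
      ≈⟨ solve 4 (λ x y z w → x :+ y :+ (z :+ w) := x :+ (y :+ z) :+ w) R.refl
           S (certificate n j) (ratio n (suc j) ⊛ X) (certificate n (suc j)) ⟩
    S ⊕ (certificate n j ⊕ ratio n (suc j) ⊛ X) ⊕ certificate n (suc j)
      ≈⟨ R.+-cong (R.+-cong (R.refl {S}) (certificate-step n j)) (R.refl {certificate n (suc j)}) ⟩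
    S ⊕ term n (suc j) ⊕ certificate n (suc j)
      ≈⟨ R.+-cong (Σˢ-last (suc j) (term n)) (R.refl {certificate n (suc j)}) ⟨
    Σˢ (suc (suc j)) (term n) ⊕ certificate n (suc j) ∎
    where
    open ≈-Reasoning
    open Solver
    S = Σˢ (suc j) (term n)
    X = q^ (expo (suc n) (suc j))

  ratio-diagonal : ∀ n → ratio n n ≈ signed n
  ratio-diagonal n = R.trans (⊛-congˡ (signed n) (⊛-inverseʳ (factorial-unital n)))
    (R.*-identityʳ (signed n))

  pentSum-suc : ∀ n → pentSum (suc n) ≈
                pentTerm -[1+ n ] ⊕ (pentSum n ⊕ pentTerm (+ suc n))
  pentSum-suc n = begin
    Σˢ (suc (suc n ℕ.+ suc n)) F
      ≡⟨ cong (λ L → Σˢ (suc L) F) (cong suc (ℕ.+-suc n n)) ⟩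
    Σˢ (suc (suc (suc (n ℕ.+ n)))) F
      ≈⟨ Σˢ-head (suc (suc (n ℕ.+ n))) F ⟩
    F 0 ⊕ Σˢ (suc (suc (n ℕ.+ n))) (λ l → F (suc l))
      ≈⟨ R.+-cong (R.refl {F 0}) (Σˢ-last (suc (n ℕ.+ n)) (λ l → F (suc l))) ⟩
    F 0 ⊕ (Σˢ (suc (n ℕ.+ n)) (λ l → F (suc l)) ⊕ F (suc (suc (n ℕ.+ n))))
      ≈⟨ R.+-cong (R.refl {F 0}) (R.+-cong
           (Σˢ-cong (suc (n ℕ.+ n)) λ l _ → R.reflexive (cong pentTerm (shift (+ l) (+ n))))
           (R.reflexive (cong pentTerm (last (+ n))))) ⟩
    pentTerm -[1+ n ] ⊕ (pentSum n ⊕ pentTerm (+ suc n)) ∎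
    where
    open ≈-Reasoning
    F : ℕ → Series
    F l = pentTerm (+ l - + suc n)
    shift : ∀ l n → 1ℤ + l - (1ℤ + n) ≡ l - n
    shift = solve-∀
    last : ∀ n → 1ℤ + (1ℤ + (n + n)) - (1ℤ + n) ≡ 1ℤ + n
    last = solve-∀

  -- Raising n changes the right side by the telescoped boundary `certificate n n` and the new last
  -- term. On the diagonal the quotient of factorials is 1, so these two are the new outermost terms
  -- of `pentSum`, at s = -(n + 1) and s = n + 1.
  shanks : ∀ n → pentSum n ≈ Σˢ (suc n) (term n)
  shanks zero = Σˢ-cong {λ l → pentTerm (+ l - 0ℤ)} {term 0} 1 λ where
    zero    _              → ⊛-congʳ 1ˢ (R.sym (ratio-diagonal 0))
    (suc _) (ℕ.s≤s ())
  shanks (suc n) = begin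
    pentSum (suc n)
      ≈⟨ pentSum-suc n ⟩
    pentTerm -[1+ n ] ⊕ (pentSum n ⊕ pentTerm (+ suc n))
      ≈⟨ R.+-cong left (R.+-cong (shanks n) right) ⟩
    certificate n n ⊕ (Σˢ (suc n) (term n) ⊕ term (suc n) (suc n))
      ≈⟨ solve 3 (λ x y z → x :+ (y :+ z) := y :+ x :+ z) R.refl
           (certificate n n) (Σˢ (suc n) (term n)) (term (suc n) (suc n)) ⟩
    Σˢ (suc n) (term n) ⊕ certificate n n ⊕ term (suc n) (suc n)
      ≈⟨ R.+-cong (telescope n n) (R.refl {term (suc n) (suc n)}) ⟨
    Σˢ (suc n) (term (suc n)) ⊕ term (suc n) (suc n)
      ≈⟨ Σˢ-last (suc n) (term (suc n)) ⟨
    Σˢ (suc (suc n)) (term (suc n)) ∎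
    where
    open ≈-Reasoning
    open Solver
    exponent₁ : ∀ n → suc n ℕ.* (3 ℕ.* n ℕ.+ 2) ≡
                2 ℕ.* (n ℕ.* suc n) ℕ.+ n ℕ.* (n ℕ.+ 1) ℕ.+ (2 ℕ.+ 2 ℕ.* n)
    exponent₁ = ℕ.solve-∀
    exponent₂ : ∀ n → n ℕ.* (3 ℕ.* n ℕ.+ 1) ≡ 2 ℕ.* (n ℕ.* n) ℕ.+ n ℕ.* (n ℕ.+ 1)
    exponent₂ = ℕ.solve-∀
    left : pentTerm -[1+ n ] ≈ certificate n n
    left = begin
      signed (suc n) ⊛ q^ (pent -[1+ n ])
        ≡⟨ cong (λ e → signed (suc n) ⊛ q^ e) (exponent₁ n) ⟩
      signed (suc n) ⊛ Y
        ≈⟨ ⊛-congʳ Y (signed-suc n) ⟩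
      ⊝ signed n ⊛ Y
        ≈⟨ solve 2 (λ x y → :- x :* y := :- (x :* y)) R.refl (signed n) Y ⟩
      ⊝ (signed n ⊛ Y)
        ≈⟨ R.-‿cong (⊛-congʳ Y (ratio-diagonal n)) ⟨
      certificate n n ∎
      where Y = q^ (expo (suc n) n ℕ.+ (2 ℕ.+ 2 ℕ.* n))
    right : pentTerm (+ suc n) ≈ term (suc n) (suc n)
    right = R.trans
      (R.reflexive (cong (λ e → signed (suc n) ⊛ q^ e) (exponent₂ (suc n))))
      (⊛-congʳ (q^ (expo (suc n) (suc n))) (R.sym (ratio-diagonal (suc n))))

-- In Shanks' sum the terms with s ≥ 1 are divisible by q^(2n + 2), so only s = 0 survives, and it
-- is the partial product (q²;q²)_n.
pentagonal : ∀ n → pentSum n ≈[ suc n ] [q^ 2 ⨾q^ 2 ]∞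
pentagonal n = begin
  pentSum n
    ≈⟨ ≈⇒≈[] (shanks n) ⟩
  Σˢ (suc n) (term n)
    ≈⟨ ≈⇒≈[] (Σˢ-head n (term n)) ⟩
  term n 0 ⊕ Σˢ n (λ s → term n (suc s))
    ≈⟨ ⊕-cong[] (≈⇒≈[] first) rest ⟩
  factorial n ⊕ 0ˢ
    ≈⟨ ≈⇒≈[] (R.+-identityʳ (factorial n)) ⟩
  factorial n
    ≈⟨ poch-≈[] 2 2 n ⟨
  [q^ 2 ⨾q^ 2 ]∞ ∎
  where
  open Shanks
  open ≈[]-Reasoning (suc n)
  1≈ : constant 1ℤ ≈ 1ˢ
  1≈ = pointwise λ where zero → refl ; (suc _) → refl
  recip1 : recip 1ˢ ≈ 1ˢ
  recip1 = R.sym (recip-unique 1-unital (R.*-identityˡ 1ˢ))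
  first : term n 0 ≈ factorial n
  first = R.trans (R.*-identityʳ (ratio n 0)) (R.trans
    (R.*-cong 1≈ (R.trans (⊛-congˡ (factorial n) recip1) (R.*-identityʳ (factorial n))))
    (R.*-identityˡ (factorial n)))
  bound : ∀ s → suc n ℕ.≤ expo n (suc s)
  bound s = ℕ.≤-trans (ℕ.m≤m+n (suc n) _) (ℕ.≤-reflexive (lemma n s))
    where
    lemma : ∀ n s → suc n ℕ.+ (1 ℕ.+ n ℕ.+ 2 ℕ.* (s ℕ.* n) ℕ.+ (s ℕ.* s ℕ.+ 3 ℕ.* s)) ≡
            2 ℕ.* (suc s ℕ.* n) ℕ.+ suc s ℕ.* (suc s ℕ.+ 1)
    lemma = ℕ.solve-∀
  rest : Σˢ n (λ s → term n (suc s)) ≈[ suc n ] 0ˢ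
  rest = Σˢ-≈0 n λ s _ → ≈[]-trans
    (≈⇒≈[] (R.*-comm (ratio n (suc s)) (q^ (expo n (suc s)))))
    (q^-⊛-≈0 (expo n (suc s)) (ratio n (suc s)) (bound s))

-- Products of two series with known leading terms

drop : ℕ → Series → Series
drop e f n = f (e ℕ.+ n)

q^-⊛-drop : ∀ e → f ≈[ e ] 0ˢ → f ≈ q^ e ⊛ drop e f
q^-⊛-drop {f} e f≈0 = pointwise λ n → go n
  where
  go : ∀ n → f n ≡ (q^ e ⊛ drop e f) n
  go n with n ℕ.<? e
  ... | yes n<e = trans (coeff< f≈0 n<e)
                    (sym (coeff< (q^-⊛-≈0 {e} e (drop e f) ℕ.≤-refl) n<e))
  ... | no n≮e  = subst (λ i → f i ≡ (q^ e ⊛ drop e f) i) (ℕ.m+[n∸m]≡n (ℕ.≮⇒≥ n≮e))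
                    (sym (q^-⊛-coeff e (drop e f) (n ∸ e)))

leading-≈0 : ∀ e i → f ≈[ e ℕ.+ i ] q^ e → f ≈[ e ] 0ˢ
leading-≈0 e i p = ≈[]-trans (≈[]-weaken (ℕ.m≤m+n e i) p) (q^-≈0 e ℕ.≤-refl)

drop-leading : ∀ e i → f ≈[ e ℕ.+ i ] q^ e → drop e f ≈[ i ] 1ˢ
drop-leading e i p = below λ {n} n<i → trans (coeff< p (ℕ.+-monoʳ-< e n<i))
  (trans (sym (coeff (R.*-identityʳ (q^ e)) (e ℕ.+ n))) (q^-⊛-coeff e 1ˢ n))

-- Precision has to be counted relative to the leading power: `⊛-cong[]` applied directly would
-- reach only min(d, e) + i. Dividing out q^d and q^e first keeps the full d + e + i.
⊛-leading : ∀ d e i → f ≈[ d ℕ.+ i ] q^ d → g ≈[ e ℕ.+ i ] q^ e →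
            f ⊛ g ≈[ d ℕ.+ e ℕ.+ i ] q^ (d ℕ.+ e)
⊛-leading {f} {g} d e i p r = begin
  f ⊛ g
    ≈⟨ ≈⇒≈[] (R.*-cong (q^-⊛-drop d (leading-≈0 d i p)) (q^-⊛-drop e (leading-≈0 e i r))) ⟩
  (q^ d ⊛ drop d f) ⊛ (q^ e ⊛ drop e g)
    ≈⟨ ≈⇒≈[] (solve 4 (λ x y z w → x :* y :* (z :* w) := x :* z :* (y :* w)) R.refl
         (q^ d) (drop d f) (q^ e) (drop e g)) ⟩
  q^ d ⊛ q^ e ⊛ (drop d f ⊛ drop e g)
    ≈⟨ ≈⇒≈[] (⊛-congʳ (drop d f ⊛ drop e g) (q^-+ d e)) ⟩
  q^ (d ℕ.+ e) ⊛ (drop d f ⊛ drop e g)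
    ≈⟨ q^-⊛-cong[] (d ℕ.+ e) (⊛-cong[] (drop-leading d i p) (drop-leading e i r)) ⟩
  q^ (d ℕ.+ e) ⊛ (1ˢ ⊛ 1ˢ)
    ≈⟨ ≈⇒≈[] (R.trans (⊛-congˡ (q^ (d ℕ.+ e)) (R.*-identityˡ 1ˢ)) (R.*-identityʳ (q^ (d ℕ.+ e)))) ⟩
  q^ (d ℕ.+ e) ∎
  where
  open ≈[]-Reasoning (d ℕ.+ e ℕ.+ i)
  open Solver

⊛-leading-quotient : ∀ {f g p s r} d e i → Unital p → Unital s → Unital r →
  f ⊛ p ^ˢ 2 ⊛ p ≈[ d ℕ.+ i ] q^ d → g ⊛ s ^ˢ 2 ⊛ r ≈[ e ℕ.+ i ] q^ e →
  f ⊛ g ≈[ d ℕ.+ e ℕ.+ i ] q^ (d ℕ.+ e) ⊛ recip (p ^ˢ 3 ⊛ s ^ˢ 2 ⊛ r)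
⊛-leading-quotient {f} {g} {p} {s} {r} d e i p₀ s₀ r₀ f≈ g≈ =
  ⊛-cancelʳ (⊛-unital (⊛-unital (^ˢ-unital 3 p₀) (^ˢ-unital 2 s₀)) r₀) (begin
    f ⊛ g ⊛ (p ^ˢ 3 ⊛ s ^ˢ 2 ⊛ r)
      ≈⟨ ≈⇒≈[] (solve 6 (λ f g p p² s² r → f :* g :* (p :* p² :* s² :* r) :=
           (f :* p² :* p) :* (g :* s² :* r)) R.refl f g p (p ^ˢ 2) (s ^ˢ 2) r) ⟩
    (f ⊛ p ^ˢ 2 ⊛ p) ⊛ (g ⊛ s ^ˢ 2 ⊛ r)
      ≈⟨ ⊛-leading d e i f≈ g≈ ⟩
    q^ (d ℕ.+ e) ∎)
  where
  open ≈[]-Reasoning (d ℕ.+ e ℕ.+ i)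
  open Solver

recip-quotient : Unital f → Unital g → g ⊛ recip (f ⊛ g) ≈ recip f
recip-quotient {f} {g} f₀ g₀ = recip-unique f₀ (R.trans
  (R.sym (R.*-assoc f g (recip (f ⊛ g)))) (⊛-inverseʳ (⊛-unital f₀ g₀)))

Θ₆-unital : Unital Θ₆
Θ₆-unital = ⊛-unital {[q^ 1 ⨾q^ 1 ]∞ ^ˢ 3} {[q^ 1 ⨾q^ 2 ]∞ ^ˢ 2}
  (^ˢ-unital 3 (poch-unital 1 1)) (^ˢ-unital 2 (poch-unital 1 2))

-- Opaque, since comparing the infinite products by unfolding does not terminate
-- in reasonable time.
opaque

  1/Θ₆Q : Series
  1/Θ₆Q = recip (Θ₆ ⊛ [q^ 2 ⨾q^ 2 ]∞)

  Q⊛1/Θ₆Q : [q^ 2 ⨾q^ 2 ]∞ ⊛ 1/Θ₆Q ≈ recip Θ₆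
  Q⊛1/Θ₆Q = recip-quotient {Θ₆} {[q^ 2 ⨾q^ 2 ]∞} Θ₆-unital (poch-unital 2 2)

  A⊛C-leading : ∀ k j i → i ℕ.≤ Leading.u 1 k → i ℕ.≤ Leading.u 2 j →
                A k ⊛ C j ≈[ lead 1 k ℕ.+ lead 2 j ℕ.+ i ]
                q^ (lead 1 k ℕ.+ lead 2 j) ⊛ 1/Θ₆Q
  A⊛C-leading k j i i≤u₁ i≤u₂ =
    ⊛-leading-quotient {A k} {C j} {[q^ 1 ⨾q^ 1 ]∞} {[q^ 1 ⨾q^ 2 ]∞} {[q^ 2 ⨾q^ 2 ]∞}
      (lead 1 k) (lead 2 j) i
      (poch-unital 1 1) (poch-unital 1 2) (poch-unital 2 2)
      (≈[]-weaken (ℕ.+-monoʳ-≤ (lead 1 k) i≤u₁) (A-leading k))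
      (≈[]-weaken (ℕ.+-monoʳ-≤ (lead 2 j) i≤u₂) (C-leading j))

-- Serves the one term of the Cauchy product that the inner sum of the theorem omits.
A-≈0 : ∀ k → A k ≈[ lead 1 k ] 0ˢ
A-≈0 k = leading-≈0-quotient (⊛-unital (^ˢ-unital 2 (poch-unital 1 1)) (poch-unital 1 1))
  (≈[]-trans (≈⇒≈[] (R.sym (R.*-assoc (A k) ([q^ 1 ⨾q^ 1 ]∞ ^ˢ 2) [q^ 1 ⨾q^ 1 ]∞)))
    (leading-≈0 (lead 1 k) _ (A-leading k)))
  where
  leading-≈0-quotient : Unital h → f ⊛ h ≈[ N ] 0ˢ → f ≈[ N ] 0ˢ
  leading-≈0-quotient {h} h₀ p = ≈[]-trans (⊛-cancelʳ h₀ p) (≈⇒≈[] (R.zeroˡ (recip h)))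

-- Exponents

base : ℕ → ℕ
base n = (3 ℕ.* n ℕ.^ 2 ℕ.+ n) ℕ./ 2

lead₁*2 : ∀ k → lead 1 k ℕ.* 2 ≡ k ℕ.* suc k
lead₁*2 zero    = refl
lead₁*2 (suc k) = trans (cong (ℕ._* 2) (cong (λ i → lead 1 k ℕ.+ suc i) (ℕ.*-identityˡ k)))
  (trans (ℕ.*-distribʳ-+ 2 (lead 1 k) (suc k)) (trans (cong (ℕ._+ suc k ℕ.* 2) (lead₁*2 k)) (lemma k)))
  where
  lemma : ∀ k → k ℕ.* suc k ℕ.+ suc k ℕ.* 2 ≡ suc k ℕ.* suc (suc k)
  lemma = ℕ.solve-∀

lead₂ : ∀ k → lead 2 k ≡ k ℕ.* k
lead₂ zero    = refl
lead₂ (suc k) = trans (cong (ℕ._+ suc (2 ℕ.* k)) (lead₂ k)) (lemma k)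
  where
  lemma : ∀ k → k ℕ.* k ℕ.+ suc (2 ℕ.* k) ≡ suc k ℕ.* suc k
  lemma = ℕ.solve-∀

leads*2 : ∀ k j → (lead 1 k ℕ.+ lead 2 j) ℕ.* 2 ≡ k ℕ.* suc k ℕ.+ j ℕ.* j ℕ.* 2
leads*2 k j = trans (ℕ.*-distribʳ-+ 2 (lead 1 k) (lead 2 j))
  (cong₂ ℕ._+_ (lead₁*2 k) (cong (ℕ._* 2) (lead₂ j)))

-- The offset in the theorem is the leading exponent at s = 0, where k = j = n; in particular the
-- division by 2 is exact.
base≡leads : ∀ n → base n ≡ lead 1 n ℕ.+ lead 2 n
base≡leads n = trans (cong (ℕ._/ 2) (trans (lemma n) (sym (leads*2 n n))))
  (ℕ.m*n/n≡m (lead 1 n ℕ.+ lead 2 n) 2)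
  where
  lemma : ∀ n → 3 ℕ.* (n ℕ.* (n ℕ.* 1)) ℕ.+ n ≡ n ℕ.* suc n ℕ.+ n ℕ.* n ℕ.* 2
  lemma = ℕ.solve-∀

leads-pent : ∀ n k j p → k ℕ.* suc k ℕ.+ j ℕ.* j ℕ.* 2 ≡ n ℕ.* suc n ℕ.+ n ℕ.* n ℕ.* 2 ℕ.+ p ℕ.* 2 →
             lead 1 k ℕ.+ lead 2 j ≡ base n ℕ.+ p
leads-pent n k j p eq = ℕ.*-cancelʳ-≡ _ _ 2 (begin
  (lead 1 k ℕ.+ lead 2 j) ℕ.* 2
    ≡⟨ trans (leads*2 k j) eq ⟩
  n ℕ.* suc n ℕ.+ n ℕ.* n ℕ.* 2 ℕ.+ p ℕ.* 2
    ≡⟨ cong (ℕ._+ p ℕ.* 2) (leads*2 n n) ⟨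
  (lead 1 n ℕ.+ lead 2 n) ℕ.* 2 ℕ.+ p ℕ.* 2
    ≡⟨ ℕ.*-distribʳ-+ 2 (lead 1 n ℕ.+ lead 2 n) p ⟨
  (lead 1 n ℕ.+ lead 2 n ℕ.+ p) ℕ.* 2
    ≡⟨ cong (λ e → (e ℕ.+ p) ℕ.* 2) (base≡leads n) ⟨
  (base n ℕ.+ p) ℕ.* 2 ∎)
  where open ≡-Reasoning

-- Writing k = n + 2 s and j = n - s.
record Exponents (n k j : ℕ) (s : ℤ) : Set where
  field
    leads : lead 1 k ℕ.+ lead 2 j ≡ base n ℕ.+ pent s
    n<₁   : n ℕ.< pent s ℕ.+ Leading.u 1 k
    n<₂   : n ℕ.< pent s ℕ.+ Leading.u 2 j

-- Each sign of s has its own parametrisation free of subtraction: by j and t for s ≥ 0, by k and t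
-- for s < 0. The excess over n + 1 is then a polynomial with nonnegative coefficients, which gives
-- both inequalities.
exponents : ∀ n k j s → + k ≡ + n + s * + 2 → + j ≡ + n - s → Exponents n k j s
exponents n k j (+ t) k≡ j≡ = helper n≡ k≡′
  where
  n≡ : n ≡ j ℕ.+ t
  n≡ = +-injective (trans (lemma (+ n) (+ t)) (cong (_+ + t) (sym j≡)))
    where
    lemma : ∀ n t → n ≡ n - t + t
    lemma = solve-∀
  k≡′ : k ≡ n ℕ.+ t ℕ.* 2
  k≡′ = +-injective (trans k≡ (cong (λ z → + n + z) (sym (pos-* t 2))))
  helper : ∀ {n k} → n ≡ j ℕ.+ t → k ≡ n ℕ.+ t ℕ.* 2 → Exponents n k j (+ t)
  helper refl refl = record
    { leads = leads-pent (j ℕ.+ t) (j ℕ.+ t ℕ.+ t ℕ.* 2) j (t ℕ.* (3 ℕ.* t ℕ.+ 1)) (lemma₁ j t)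
    ; n<₁   = ℕ.≤-trans (ℕ.m≤m+n _ _) (ℕ.≤-reflexive (lemma₂ j t))
    ; n<₂   = ℕ.≤-trans (ℕ.m≤m+n _ _) (ℕ.≤-reflexive (lemma₃ j t))
    }
    where
    lemma₁ : ∀ j t → (j ℕ.+ t ℕ.+ t ℕ.* 2) ℕ.* suc (j ℕ.+ t ℕ.+ t ℕ.* 2) ℕ.+ j ℕ.* j ℕ.* 2 ≡
      (j ℕ.+ t) ℕ.* suc (j ℕ.+ t) ℕ.+ (j ℕ.+ t) ℕ.* (j ℕ.+ t) ℕ.* 2 ℕ.+ t ℕ.* (3 ℕ.* t ℕ.+ 1) ℕ.* 2
    lemma₁ = ℕ.solve-∀
    lemma₂ : ∀ j t → suc (j ℕ.+ t) ℕ.+ (3 ℕ.* (t ℕ.* t) ℕ.+ 3 ℕ.* t) ≡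
      t ℕ.* (3 ℕ.* t ℕ.+ 1) ℕ.+ suc (1 ℕ.* (j ℕ.+ t ℕ.+ t ℕ.* 2))
    lemma₂ = ℕ.solve-∀
    lemma₃ : ∀ j t → suc (j ℕ.+ t) ℕ.+ (3 ℕ.* (t ℕ.* t) ℕ.+ j) ≡
      t ℕ.* (3 ℕ.* t ℕ.+ 1) ℕ.+ suc (2 ℕ.* j)
    lemma₃ = ℕ.solve-∀
exponents n k j -[1+ t ] k≡ j≡ = helper n≡ (+-injective j≡)
  where
  n≡ : n ≡ k ℕ.+ suc t ℕ.* 2
  n≡ = +-injective (trans (lemma (+ n) (+ suc t)) (cong₂ _+_ (sym k≡) (sym (pos-* (suc t) 2))))
    where
    lemma : ∀ n t → n ≡ n + (- t) * + 2 + t * + 2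
    lemma = solve-∀
  helper : ∀ {n j} → n ≡ k ℕ.+ suc t ℕ.* 2 → j ≡ n ℕ.+ suc t → Exponents n k j -[1+ t ]
  helper refl refl = record
    { leads = leads-pent (k ℕ.+ suc t ℕ.* 2) k (k ℕ.+ suc t ℕ.* 2 ℕ.+ suc t) (suc t ℕ.* (3 ℕ.* t ℕ.+ 2)) (lemma₁ k t)
    ; n<₁   = ℕ.≤-trans (ℕ.m≤m+n _ _) (ℕ.≤-reflexive (lemma₂ k t))
    ; n<₂   = ℕ.≤-trans (ℕ.m≤m+n _ _) (ℕ.≤-reflexive (lemma₃ k t))
    }
    where
    lemma₁ : ∀ k t → k ℕ.* suc k ℕ.+
        (k ℕ.+ suc t ℕ.* 2 ℕ.+ suc t) ℕ.* (k ℕ.+ suc t ℕ.* 2 ℕ.+ suc t) ℕ.* 2 ≡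
      (k ℕ.+ suc t ℕ.* 2) ℕ.* suc (k ℕ.+ suc t ℕ.* 2) ℕ.+
        (k ℕ.+ suc t ℕ.* 2) ℕ.* (k ℕ.+ suc t ℕ.* 2) ℕ.* 2 ℕ.+ suc t ℕ.* (3 ℕ.* t ℕ.+ 2) ℕ.* 2
    lemma₁ = ℕ.solve-∀
    lemma₂ : ∀ k t → suc (k ℕ.+ suc t ℕ.* 2) ℕ.+ (3 ℕ.* (t ℕ.* t) ℕ.+ 3 ℕ.* t) ≡
      suc t ℕ.* (3 ℕ.* t ℕ.+ 2) ℕ.+ suc (1 ℕ.* k)
    lemma₂ = ℕ.solve-∀
    lemma₃ : ∀ k t → suc (k ℕ.+ suc t ℕ.* 2) ℕ.+ (3 ℕ.* (t ℕ.* t) ℕ.+ 9 ℕ.* t ℕ.+ k ℕ.+ 6) ≡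
      suc t ℕ.* (3 ℕ.* t ℕ.+ 2) ℕ.+ suc (2 ℕ.* (k ℕ.+ suc t ℕ.* 2 ℕ.+ suc t))
    lemma₃ = ℕ.solve-∀

A⊛C-coeff : ∀ {n k j s} → Exponents n k j s → ∀ {m} → m ℕ.≤ n →
            (A k ⊛ C j) (base n ℕ.+ m) ≡ (q^ (pent s) ⊛ 1/Θ₆Q) m
A⊛C-coeff {n} {k} {j} {s} ex {m} m≤n = begin
  (A k ⊛ C j) (base n ℕ.+ m)
    -- This relative precision is just enough to reach the coefficient of index `base n ℕ.+ n`. If
    -- `pent s` exceeds n it is truncated to 0, and then both coefficients compared are 0.
    ≡⟨ coeff< (A⊛C-leading k j (suc n ∸ pent s)
         (ℕ.m≤n+o⇒m∸n≤o (suc n) (pent s) n<₁) (ℕ.m≤n+o⇒m∸n≤o (suc n) (pent s) n<₂)) in-range ⟩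
  (q^ (lead 1 k ℕ.+ lead 2 j) ⊛ 1/Θ₆Q) (base n ℕ.+ m)
    ≡⟨ cong (λ e → (q^ e ⊛ 1/Θ₆Q) (base n ℕ.+ m)) leads ⟩
  (q^ (base n ℕ.+ pent s) ⊛ 1/Θ₆Q) (base n ℕ.+ m)
    ≡⟨ coeff (R.trans (⊛-congʳ 1/Θ₆Q (R.sym (q^-+ (base n) (pent s))))
         (R.*-assoc (q^ (base n)) (q^ (pent s)) 1/Θ₆Q)) (base n ℕ.+ m) ⟩
  (q^ (base n) ⊛ (q^ (pent s) ⊛ 1/Θ₆Q)) (base n ℕ.+ m)
    ≡⟨ q^-⊛-coeff (base n) (q^ (pent s) ⊛ 1/Θ₆Q) m ⟩
  (q^ (pent s) ⊛ 1/Θ₆Q) m ∎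
  where
  open ≡-Reasoning
  open Exponents ex
  in-range : base n ℕ.+ m ℕ.< lead 1 k ℕ.+ lead 2 j ℕ.+ (suc n ∸ pent s)
  in-range = ℕ.≤-trans (ℕ.s≤s (ℕ.+-monoʳ-≤ (base n) m≤n)) (ℕ.≤-trans
    (ℕ.≤-reflexive (sym (ℕ.+-suc (base n) n)))
    (ℕ.≤-trans (ℕ.+-monoʳ-≤ (base n) (ℕ.m≤n+m∸n (suc n) (pent s)))
    (ℕ.≤-reflexive (trans (sym (ℕ.+-assoc (base n) (pent s) (suc n ∸ pent s)))
      (cong (ℕ._+ (suc n ∸ pent s)) (sym leads))))))

-- The summation range

pent-value : ∀ s → + pent s ≡ s * (+ 3 * s + 1ℤ)
pent-value (+ n) = trans (pos-* n (3 ℕ.* n ℕ.+ 1)) (cong (λ x → + n * (x + 1ℤ)) (pos-* 3 n))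
pent-value -[1+ n ] = trans (pos-* (suc n) (3 ℕ.* n ℕ.+ 2))
  (trans (cong (λ x → + suc n * (x + + 2)) (pos-* 3 n)) (lemma (+ n)))
  where
  lemma : ∀ x → (1ℤ + x) * (+ 3 * x + + 2) ≡ (- (1ℤ + x)) * (+ 3 * (- (1ℤ + x)) + 1ℤ)
  lemma = solve-∀

-- Completing the square gives (6s + 1)² = 12(3s² + s) + 1, and 12n + 13 is 12(n + 1) + 1: this is
-- the origin of the radicand in `root`.
square⇒n<pent : ∀ n s → + (12 ℕ.* n ℕ.+ 13) ≤ (+ 6 * s + 1ℤ) * (+ 6 * s + 1ℤ) → n ℕ.< pent s
square⇒n<pent n s d≤ = ℕ.*-cancelˡ-≤ 12 (ℕ.+-cancelʳ-≤ 1 (12 ℕ.* suc n) (12 ℕ.* pent s)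
  (ℕ.≤-trans (ℕ.≤-reflexive (lemma₂ n)) (drop‿+≤+ (≤-trans d≤ (≤-reflexive (trans (lemma₁ s)
    (sym (cong (_+ 1ℤ) (trans (pos-* 12 (pent s)) (cong (+ 12 *_) (pent-value s)))))))))))
  where
  lemma₁ : ∀ s → (+ 6 * s + 1ℤ) * (+ 6 * s + 1ℤ) ≡ + 12 * (s * (+ 3 * s + 1ℤ)) + 1ℤ
  lemma₁ = solve-∀
  lemma₂ : ∀ n → 12 ℕ.* suc n ℕ.+ 1 ≡ 12 ℕ.* n ℕ.+ 13
  lemma₂ = ℕ.solve-∀

≤0⇒square-antitone : ∀ {x y} → x ≤ y → y ≤ 0ℤ → y * y ≤ x * x
≤0⇒square-antitone {x} {y} x≤y y≤0 = ≤-trans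
  (*-monoʳ-≤-nonPos y {{nonPositive y≤0}} x≤y)
  (*-monoˡ-≤-nonPos x {{nonPositive (≤-trans x≤y y≤0)}} x≤y)

-- Both ends of the range reduce to a floor with a minus sign, since `⌈_⌉` is the negated floor of
-- `-ˢ_`, which flips the sign. At the floor, c z - p is nonpositive with square at least d; a
-- smaller z only enlarges the square.
≤⌊⌋⇒≤square : ∀ p d c .{{_ : ℕ.NonZero c}} z → z ≤ ⌊ surd p Sign.- d c ⌋ →
              + d ≤ (+ c * z - p) * (+ c * z - p)
≤⌊⌋⇒≤square p d c z z≤ = ≤-trans (proj₂ floor≤)
  (≤0⇒square-antitone (+-monoˡ-≤ (- p) (*-monoˡ-≤-nonNeg (+ c) z≤)) (proj₁ floor≤))
  where
  floor≤ : ⌊ surd p Sign.- d c ⌋ ≤ˢ surd p Sign.- d c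
  floor≤ = proj₁ (proj₂ (floor (surd p Sign.- d c)))

below-range : ∀ n s → + n + s * + 2 < r₁ n → n ℕ.< pent s
below-range n s k<r₁ = square⇒n<pent n s (≤-trans
  (≤⌊⌋⇒≤square (+ 3 * + n - 1ℤ) (12 ℕ.* n ℕ.+ 13) 3 (+ n + s * + 2) k≤⌊⌋)
  (≤-reflexive (lemma (+ n) s)))
  where
  cancel : ∀ x → x + 1ℤ - 1ℤ ≡ x
  cancel = solve-∀
  k≤⌊⌋ : + n + s * + 2 ≤ ⌊ root Sign.- n ⌋
  k≤⌊⌋ = ≤-trans (i<j⇒i≤pred[j] k<r₁)
    (≤-reflexive (trans (+-comm -1ℤ (r₁ n)) (cancel ⌊ root Sign.- n ⌋)))
  lemma : ∀ n s → (+ 3 * (n + s * + 2) - (+ 3 * n - 1ℤ)) * (+ 3 * (n + s * + 2) - (+ 3 * n - 1ℤ)) ≡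
                  (+ 6 * s + 1ℤ) * (+ 6 * s + 1ℤ)
  lemma = solve-∀

above-range : ∀ n s → r₂ n < + n + s * + 2 → n ℕ.< pent s
above-range n s r₂<k = square⇒n<pent n s (≤-trans
  (≤⌊⌋⇒≤square (- (+ 3 * + n - 1ℤ)) (12 ℕ.* n ℕ.+ 13) 3 (- (+ n + s * + 2)) -k≤⌊⌋)
  (≤-reflexive (lemma (+ n) s)))
  where
  cancel : ∀ x → - (1ℤ + (- x - 1ℤ)) ≡ x
  cancel = solve-∀
  -k≤⌊⌋ : - (+ n + s * + 2) ≤ ⌊ -ˢ root Sign.+ n ⌋
  -k≤⌊⌋ = ≤-trans (neg-mono-≤ (i<j⇒suc[i]≤j r₂<k)) (≤-reflexive (cancel ⌊ -ˢ root Sign.+ n ⌋))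
  lemma : ∀ n s → (+ 3 * (- (n + s * + 2)) - (- (+ 3 * n - 1ℤ))) * (+ 3 * (- (n + s * + 2)) - (- (+ 3 * n - 1ℤ))) ≡
                  (+ 6 * s + 1ℤ) * (+ 6 * s + 1ℤ)
  lemma = solve-∀

-- Outside the range k = n, that is s = 0, would force n < `pent 0ℤ`, which is 0. With `n≤r₂` the
-- range is nonempty, so its length may be read off from r₂ - r₁ + 1.
r₁≤n : ∀ n → r₁ n ≤ + n
r₁≤n n = ≮⇒≥ λ n<r₁ → contradiction
  (below-range n 0ℤ (subst (_< r₁ n) (sym (+-identityʳ (+ n))) n<r₁)) ℕ.n≮0

n≤r₂ : ∀ n → + n ≤ r₂ n
n≤r₂ n = ≮⇒≥ λ r₂<n → contradiction
  (above-range n 0ℤ (subst (r₂ n <_) (sym (+-identityʳ (+ n))) r₂<n)) ℕ.n≮0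

∑ℤ≡∑ℕ : ∀ {lo hi} F L → hi ≡ lo + + L - 1ℤ → ∑ℤ lo hi F ≡ ∑ℕ L (λ i → F (lo + + i))
∑ℤ≡∑ℕ {lo} F L refl = cong (λ K → ∑ℕ K (λ i → F (lo + + i)))
  (trans (cong (λ z → ∣ z ⊔ 0ℤ ∣) (lemma lo (+ L))) (ℕ.⊔-identityʳ L))
  where
  lemma : ∀ x y → x + y - 1ℤ - x + 1ℤ ≡ y
  lemma = solve-∀

-- `p` and `r` count the indices added before and after the original `L`.
∑ℤ-extend : ∀ {lo hi b} F G p L r → lo ≡ b + + p → hi ≡ lo + + L - 1ℤ →
            (∀ k → lo ≤ k → k ≤ hi → F k ≡ G k) →
            (∀ k → k < lo → G k ≡ 0ℤ) → (∀ k → hi < k → G k ≡ 0ℤ) →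
            ∑ℤ lo hi F ≡ ∑ℕ (p ℕ.+ (L ℕ.+ r)) (λ i → G (b + + i))
∑ℤ-extend {b = b} F G p L r refl refl F≡G G≡0₁ G≡0₂ = begin
  ∑ℤ lo (lo + + L - 1ℤ) F
    ≡⟨ ∑ℤ≡∑ℕ {lo} F L refl ⟩
  ∑ℕ L (λ i → F (lo + + i))
    ≡⟨ ∑ℕ-cong L (λ i i<L → F≡G (lo + + i) (i≤i+j lo (+ i))
         (subst (_≤ lo + + L - 1ℤ) (cancel lo (+ i)) (+-monoˡ-≤ -1ℤ (+-monoʳ-≤ lo (+≤+ i<L))))) ⟩
  ∑ℕ L (λ i → G (lo + + i))
    ≡⟨ ∑ℕ-cong L (λ i _ → cong G (+-assoc b (+ p) (+ i))) ⟩
  ∑ℕ L (λ i → G (b + + (p ℕ.+ i)))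
    ≡⟨ +-identityʳ (∑ℕ L (λ i → G (b + + (p ℕ.+ i)))) ⟨
  ∑ℕ L (λ i → G (b + + (p ℕ.+ i))) + 0ℤ
    ≡⟨ cong (λ z → ∑ℕ L (λ i → G (b + + (p ℕ.+ i))) + z) (∑ℕ-zero r λ i _ → G≡0₂ _ (above i)) ⟨
  ∑ℕ L (λ i → G (b + + (p ℕ.+ i))) + ∑ℕ r (λ i → G (b + + (p ℕ.+ (L ℕ.+ i))))
    ≡⟨ ∑ℕ-++ (λ i → G (b + + (p ℕ.+ i))) L r ⟨
  ∑ℕ (L ℕ.+ r) (λ i → G (b + + (p ℕ.+ i)))
    ≡⟨ +-identityˡ (∑ℕ (L ℕ.+ r) (λ i → G (b + + (p ℕ.+ i)))) ⟨
  0ℤ + ∑ℕ (L ℕ.+ r) (λ i → G (b + + (p ℕ.+ i)))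
    ≡⟨ cong (λ z → z + ∑ℕ (L ℕ.+ r) (λ i → G (b + + (p ℕ.+ i))))
         (∑ℕ-zero p λ i i<p → G≡0₁ _ (+-monoʳ-< b (+<+ i<p))) ⟨
  ∑ℕ p (λ i → G (b + + i)) + ∑ℕ (L ℕ.+ r) (λ i → G (b + + (p ℕ.+ i)))
    ≡⟨ ∑ℕ-++ (λ i → G (b + + i)) p (L ℕ.+ r) ⟨
  ∑ℕ (p ℕ.+ (L ℕ.+ r)) (λ i → G (b + + i)) ∎
  where
  open ≡-Reasoning
  lo = b + + p
  cancel : ∀ x i → x + (1ℤ + i) - 1ℤ ≡ x + i
  cancel = solve-∀
  above : ∀ i → lo + + L - 1ℤ < b + + (p ℕ.+ (L ℕ.+ i))
  above i = suc[i]≤j⇒i<j (≤-trans (≤-reflexive (lemma b (+ p) (+ L)))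
    (+-monoʳ-≤ b (+≤+ (ℕ.+-monoʳ-≤ p (ℕ.m≤m+n L i)))))
    where
    lemma : ∀ b p L → 1ℤ + (b + p + L - 1ℤ) ≡ b + (p + L)
    lemma = solve-∀

-- The summands

-- Twice the distance from s to the quotient equals the remainder, which is less than 2.
half : ∀ s {x} → x ≡ s * + 2 → x / + 2 ≡ s
half s {x} x≡ = sym (i-j≡0⇒i≡j s (x / + 2) (∣i∣≡0⇒i≡0 ∣s-q∣≡0))
  where
  cancel : ∀ s q r → s * + 2 ≡ r + q * + 2 → (s - q) * + 2 ≡ r
  cancel s q r eq = trans (expand s q) (trans (cong (λ z → z - q * + 2) eq) (collapse r (q * + 2)))
    where
    expand : ∀ s q → (s - q) * + 2 ≡ s * + 2 - q * + 2
    expand = solve-∀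
    collapse : ∀ r y → r + y - y ≡ r
    collapse = solve-∀
  ∣s-q∣*2≡r : ∣ s - x / + 2 ∣ ℕ.* 2 ≡ x % + 2
  ∣s-q∣*2≡r = trans (sym (abs-* (s - x / + 2) (+ 2)))
    (cong ∣_∣ (cancel s (x / + 2) (+ (x % + 2)) (trans (sym x≡) (a≡a%n+[a/n]*n x (+ 2)))))
  ∣s-q∣≡0 : ∣ s - x / + 2 ∣ ≡ 0
  ∣s-q∣≡0 = ℕ.n<1⇒n≡0 (ℕ.*-cancelʳ-< 2 ∣ s - x / + 2 ∣ 1
    (subst (ℕ._< 2) (sym ∣s-q∣*2≡r) (n%d<d x (+ 2))))

constant-⊛ : ∀ c f n → (constant c ⊛ f) n ≡ c * f n
constant-⊛ c f zero    = +-identityʳ (c * f 0)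
constant-⊛ c f (suc n) = trans (cong (λ z → c * f (suc n) + z) (0-⊛ (λ _ → refl) f n))
  (+-identityʳ (c * f (suc n)))

-- The sum stops one short of the full Cauchy product; the missing term is `A k K * C j 0`. For j ≥
-- 1 its second factor is an empty sum. For j = 0 one has s = n, and K lies below the leading
-- exponent of `A k` because n ≥ 1 gives n < 3n² + n.
A⊛C-truncated : ∀ {n k j s} → 1 ℕ.≤ n → + j ≡ + n - s → Exponents n k j s → ∀ {m} → m ℕ.≤ n →
  ∑ℕ (m ℕ.+ base n) (λ r → A k r * C j (m ℕ.+ base n ∸ r)) ≡ (q^ (pent s) ⊛ 1/Θ₆Q) m
A⊛C-truncated {n} {k} {j} {s} 1≤n j≡ ex {m} m≤n = begin
  ∑ℕ K F
    ≡⟨ +-identityʳ (∑ℕ K F) ⟨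
  ∑ℕ K F + 0ℤ
    ≡⟨ cong (λ z → ∑ℕ K F + z) (trans (cong (λ i → A k K * C j i) (ℕ.n∸n≡0 K)) (omitted j j≡ ex)) ⟨
  ∑ℕ K F + F K
    ≡⟨ ∑ℕ-last F K ⟨
  (A k ⊛ C j) K
    ≡⟨ cong (A k ⊛ C j) (ℕ.+-comm m (base n)) ⟩
  (A k ⊛ C j) (base n ℕ.+ m)
    ≡⟨ A⊛C-coeff ex m≤n ⟩
  (q^ (pent s) ⊛ 1/Θ₆Q) m ∎
  where
  open ≡-Reasoning
  K = m ℕ.+ base n
  F : ℕ → ℤ
  F r = A k r * C j (K ∸ r)

  n<pent : n ℕ.< pent (+ n)
  n<pent = ℕ.≤-trans (ℕ.+-mono-≤ (ℕ.*-mono-≤ 1≤n (ℕ.≤-trans 1≤n (ℕ.m≤n*m n 3))) (ℕ.≤-refl {n}))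
    (ℕ.≤-reflexive (lemma n))
    where
    lemma : ∀ n → n ℕ.* (3 ℕ.* n) ℕ.+ n ≡ n ℕ.* (3 ℕ.* n ℕ.+ 1)
    lemma = ℕ.solve-∀

  omitted : ∀ j → + j ≡ + n - s → Exponents n k j s → A k K * C j 0 ≡ 0ℤ
  omitted (suc j) _  _  = *-zeroʳ (A k K)
  omitted zero    j≡ ex = trans (cong (_* C 0 0) (trans (coeff< (A-≈0 k) K<lead) (0ˢ≡0 K))) (*-zeroˡ (C 0 0))
    where
    K<lead : K ℕ.< lead 1 k
    K<lead = subst (K ℕ.<_) (trans (cong (λ s → base n ℕ.+ pent s) (i-j≡0⇒i≡j (+ n) s (sym j≡)))
        (trans (sym (Exponents.leads ex)) (ℕ.+-identityʳ (lead 1 k))))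
      (subst (ℕ._< base n ℕ.+ pent (+ n)) (ℕ.+-comm (base n) m)
        (ℕ.+-monoʳ-< (base n) (ℕ.≤-<-trans m≤n n<pent)))

summand : ℕ → ℕ → ℤ → ℤ
summand n m k =
  if does (+ 2 ∣? (k - + n))
  then (-1ℤ ^ ∣ (+ n - k) / + 2 ∣) *
       ∑ℕ (m ℕ.+ base n) (λ r → 𝔪 (∣ k ∣) r * 𝔪-odd (∣ (+ 3 * + n - k) / + 2 ∣) (m ℕ.+ base n ∸ r))
  else 0ℤ

-- Unlike summand n m, this vanishes outside the range [r₁ n , r₂ n], so that
-- its sum can be extended to k = n + 2 s with -n ≤ s ≤ n.
reduced : ℕ → ℕ → ℤ → ℤ
reduced n m k =
  if does (+ 2 ∣? (k - + n)) then (pentTerm ((k - + n) / + 2) ⊛ 1/Θ₆Q) m else 0ℤ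

if-yes : ∀ {P : Set} (P? : Dec P) {x y : ℤ} → P → (if does P? then x else y) ≡ x
if-yes P? {x} {y} p = cong (if_then x else y) (dec-true P? p)

if-no : ∀ {P : Set} (P? : Dec P) {x y : ℤ} → ¬ P → (if does P? then x else y) ≡ y
if-no P? {x} {y} ¬p = cong (if_then x else y) (dec-false P? ¬p)

reduced-even : ∀ n m k s → k - + n ≡ s * + 2 → reduced n m k ≡ (pentTerm s ⊛ 1/Θ₆Q) m
reduced-even n m k s eq = trans (if-yes (+ 2 ∣? (k - + n)) (divides s eq))
  (cong (λ t → (pentTerm t ⊛ 1/Θ₆Q) m) (half s eq))

shift-even : ∀ {n k s} → k - + n ≡ s * + 2 → k ≡ + n + s * + 2
shift-even {n} {k} {s} eq = trans (lemma k (+ n)) (cong (λ z → + n + z) eq)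
  where
  lemma : ∀ k n → k ≡ n + (k - n)
  lemma = solve-∀

reduced-zero : ∀ n m k → m ℕ.≤ n → (∀ s → k ≡ + n + s * + 2 → n ℕ.< pent s) → reduced n m k ≡ 0ℤ
reduced-zero n m k m≤n large = go (+ 2 ∣? (k - + n))
  where
  go : Dec ((+ 2) Signed.∣ (k - + n)) → reduced n m k ≡ 0ℤ
  go (no 2∤)            = if-no (+ 2 ∣? (k - + n)) 2∤
  go (yes (divides s eq)) = begin
    reduced n m k
      ≡⟨ reduced-even n m k s eq ⟩
    (signed ∣ s ∣ ⊛ q^ (pent s) ⊛ 1/Θ₆Q) m
      ≡⟨ coeff (solve 3 (λ x y z → x :* y :* z := y :* (x :* z)) R.refl
           (signed ∣ s ∣) (q^ (pent s)) 1/Θ₆Q) m ⟩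
    (q^ (pent s) ⊛ (signed ∣ s ∣ ⊛ 1/Θ₆Q)) m
      ≡⟨ coeff< (q^-⊛-≈0 (pent s) (signed ∣ s ∣ ⊛ 1/Θ₆Q) ℕ.≤-refl)
           (ℕ.≤-<-trans m≤n (large s (shift-even {n} {k} {s} eq))) ⟩
    0ˢ m
      ≡⟨ 0ˢ≡0 m ⟩
    0ℤ ∎
    where
    open ≡-Reasoning
    open Solver

-- If k = n + 2s, then (3n - k)/2 = n - s and (n - k)/2 = -s. The bounds on k make k and n - s
-- nonnegative, so taking absolute values changes neither.
summand≡reduced : ∀ n m k → 1 ℕ.≤ n → m ℕ.≤ n → 0ℤ ≤ k → k ≤ + 3 * + n →
                  summand n m k ≡ reduced n m k
summand≡reduced n m k 1≤n m≤n 0≤k k≤3n = go (+ 2 ∣? (k - + n))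
  where
  go : Dec ((+ 2) Signed.∣ (k - + n)) → summand n m k ≡ reduced n m k
  go (no 2∤)            = trans (if-no (+ 2 ∣? (k - + n)) 2∤) (sym (if-no (+ 2 ∣? (k - + n)) 2∤))
  go (yes (divides s eq)) = begin
    summand n m k
      ≡⟨ if-yes (+ 2 ∣? (k - + n)) (divides s eq) ⟩
    (-1ℤ ^ ∣ (+ n - k) / + 2 ∣) * ∑ℕ (m ℕ.+ base n) (λ r → A (∣ k ∣) r * C j (m ℕ.+ base n ∸ r))
      ≡⟨ cong₂ (λ e x → (-1ℤ ^ e) * x) sign-exponent
           (A⊛C-truncated 1≤n j≡ (exponents n ∣ k ∣ j s k≡ j≡) m≤n) ⟩
    (-1ℤ ^ ∣ s ∣) * (q^ (pent s) ⊛ 1/Θ₆Q) m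
      ≡⟨ constant-⊛ (-1ℤ ^ ∣ s ∣) (q^ (pent s) ⊛ 1/Θ₆Q) m ⟨
    (signed ∣ s ∣ ⊛ (q^ (pent s) ⊛ 1/Θ₆Q)) m
      ≡⟨ ⊛-assoc (signed ∣ s ∣) (q^ (pent s)) 1/Θ₆Q m ⟨
    (pentTerm s ⊛ 1/Θ₆Q) m
      ≡⟨ reduced-even n m k s eq ⟨
    reduced n m k ∎
    where
    open ≡-Reasoning
    j = ∣ (+ 3 * + n - k) / + 2 ∣

    k≡ : + ∣ k ∣ ≡ + n + s * + 2
    k≡ = trans (0≤i⇒+∣i∣≡i 0≤k) (shift-even {n} {k} {s} eq)

    complement : + 3 * + n - k ≡ (+ n - s) * + 2
    complement = trans (expand (+ n) k) (trans (cong (λ z → + n * + 2 - z) eq) (collect (+ n) s))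
      where
      expand : ∀ n k → + 3 * n - k ≡ n * + 2 - (k - n)
      expand = solve-∀
      collect : ∀ n s → n * + 2 - s * + 2 ≡ (n - s) * + 2
      collect = solve-∀

    0≤n-s : 0ℤ ≤ + n - s
    0≤n-s = *-cancelʳ-≤-pos 0ℤ (+ n - s) (+ 2)
      (≤-trans (i≤j⇒0≤j-i k≤3n) (≤-reflexive complement))

    j≡ : + j ≡ + n - s
    j≡ = trans (cong (λ z → + ∣ z ∣) (half (+ n - s) complement)) (0≤i⇒+∣i∣≡i 0≤n-s)

    sign-exponent : ∣ (+ n - k) / + 2 ∣ ≡ ∣ s ∣
    sign-exponent = trans (cong ∣_∣ (half (- s) (trans (flip (+ n) k)
      (trans (cong -_ eq) (neg-distribˡ-* s (+ 2)))))) (∣-i∣≡∣i∣ s)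
      where
      flip : ∀ n k → n - k ≡ - (k - n)
      flip = solve-∀

reduced-odd : ∀ n m l → reduced n m (- + n + + suc (l ℕ.+ l)) ≡ 0ℤ
reduced-odd n m l = if-no (+ 2 ∣? (- + n + + suc (l ℕ.+ l) - + n)) λ {
  (divides s eq) → odd≢even (+ l - + n) s (trans (lemma (+ n) (+ l)) eq) }
  where
  lemma : ∀ n l → 1ℤ + (l - n) * + 2 ≡ - n + (1ℤ + (l + l)) - n
  lemma = solve-∀
  isolate : ∀ x y → 1ℤ ≡ (1ℤ + x * + 2) - x * + 2
  isolate = solve-∀
  collect : ∀ x y → y * + 2 - x * + 2 ≡ (y - x) * + 2
  collect = solve-∀
  1≢t*2 : ∀ t → ¬ (1 ≡ t ℕ.* 2)
  1≢t*2 zero    ()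
  1≢t*2 (suc t) ()
  odd≢even : ∀ x y → ¬ (1ℤ + x * + 2 ≡ y * + 2)
  odd≢even x y eq = 1≢t*2 ∣ y - x ∣ (trans
    (cong ∣_∣ (trans (isolate x y) (trans (cong (_- x * + 2) eq) (collect x y))))
    (abs-* (y - x) (+ 2)))

-- Summation over s

signed-pentagonal : ∀ n m → m ℕ.≤ n →
                    ∑ℕ (suc (n ℕ.+ n)) (λ l → (pentTerm (+ l - + n) ⊛ 1/Θ₆Q) m) ≡ recip Θ₆ m
signed-pentagonal n m m≤n = begin
  ∑ℕ (suc (n ℕ.+ n)) (λ l → (F l ⊛ 1/Θ₆Q) m)
    ≡⟨ coeff (Σˢ-cong {λ l → F l ⊛ 1/Θ₆Q} {λ l → 1/Θ₆Q ⊛ F l} (suc (n ℕ.+ n))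
         λ l _ → R.*-comm (F l) 1/Θ₆Q) m ⟩
  Σˢ (suc (n ℕ.+ n)) (λ l → 1/Θ₆Q ⊛ F l) m
    ≡⟨ coeff (⊛-Σˢ (suc (n ℕ.+ n)) 1/Θ₆Q F) m ⟨
  (1/Θ₆Q ⊛ pentSum n) m
    ≡⟨ coeff< (⊛-congˡ[] 1/Θ₆Q (pentagonal n)) (ℕ.s≤s m≤n) ⟩
  (1/Θ₆Q ⊛ [q^ 2 ⨾q^ 2 ]∞) m
    ≡⟨ ⊛-comm 1/Θ₆Q [q^ 2 ⨾q^ 2 ]∞ m ⟩
  ([q^ 2 ⨾q^ 2 ]∞ ⊛ 1/Θ₆Q) m
    ≡⟨ coeff Q⊛1/Θ₆Q m ⟩
  recip Θ₆ m ∎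
  where
  open ≡-Reasoning
  F : ℕ → Series
  F l = pentTerm (+ l - + n)

-- The range is widened to the 4n + 1 integers from -n to 3n. Those at even distance from n are k =
-- n + 2(l - n) with 0 ≤ l ≤ 2n, the indices of `pentSum n`; the others contribute zero.
∑-summand : ∀ n → 1 ℕ.≤ n → ∀ m → m ℕ.≤ n → ∑ℤ (r₁ n) (r₂ n) (summand n m) ≡ recip Θ₆ m
∑-summand n 1≤n m m≤n = begin
  ∑ℤ (r₁ n) (r₂ n) (summand n m)
    ≡⟨ ∑ℤ-extend {b = - + n} (summand n m) (reduced n m) p L r lo≡ hi≡
         (λ k r₁≤k k≤r₂ → summand≡reduced n m k 1≤n m≤n (≤-trans (0≤r₁ n 1≤n) r₁≤k)
           (≤-trans k≤r₂ r₂≤))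
         (λ k k<r₁ → reduced-zero n m k m≤n λ s k≡ → below-range n s (subst (_< r₁ n) k≡ k<r₁))
         (λ k r₂<k → reduced-zero n m k m≤n λ s k≡ → above-range n s (subst (r₂ n <_) k≡ r₂<k)) ⟩
  ∑ℕ (p ℕ.+ (L ℕ.+ r)) (λ i → reduced n m (- + n + + i))
    ≡⟨ cong (λ K → ∑ℕ K (λ i → reduced n m (- + n + + i))) total ⟩
  ∑ℕ (suc ((n ℕ.+ n) ℕ.+ (n ℕ.+ n))) (λ i → reduced n m (- + n + + i))
    ≡⟨ ∑ℕ-evens (λ i → reduced n m (- + n + + i)) (n ℕ.+ n) (reduced-odd n m) ⟩
  ∑ℕ (suc (n ℕ.+ n)) (λ l → reduced n m (- + n + + (l ℕ.+ l)))
    ≡⟨ ∑ℕ-cong (suc (n ℕ.+ n)) (λ l _ →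
         reduced-even n m (- + n + + (l ℕ.+ l)) (+ l - + n) (even (+ n) (+ l))) ⟩
  ∑ℕ (suc (n ℕ.+ n)) (λ l → (pentTerm (+ l - + n) ⊛ 1/Θ₆Q) m)
    ≡⟨ signed-pentagonal n m m≤n ⟩
  recip Θ₆ m ∎
  where
  open ≡-Reasoning

  even : ∀ n l → - n + (l + l) - n ≡ (l - n) * + 2
  even = solve-∀

  r₂≤ : r₂ n ≤ + 3 * + n
  r₂≤ = ≤-trans (r₂≤3n n) (≤-reflexive (pos-* 3 n))

  p L r : ℕ
  p = ∣ r₁ n + + n ∣
  L = ∣ r₂ n - r₁ n + 1ℤ ∣
  r = ∣ + 3 * + n - r₂ n ∣

  p≡ : + p ≡ r₁ n + + n
  p≡ = 0≤i⇒+∣i∣≡i (+-mono-≤ (0≤r₁ n 1≤n) (+≤+ ℕ.z≤n))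
  L≡ : + L ≡ r₂ n - r₁ n + 1ℤ
  L≡ = 0≤i⇒+∣i∣≡i (+-mono-≤ (i≤j⇒0≤j-i (≤-trans (r₁≤n n) (n≤r₂ n))) (+≤+ ℕ.z≤n))
  r≡ : + r ≡ + 3 * + n - r₂ n
  r≡ = 0≤i⇒+∣i∣≡i (i≤j⇒0≤j-i r₂≤)

  lo≡ : r₁ n ≡ - + n + + p
  lo≡ = trans (lemma (r₁ n) (+ n)) (cong (λ z → - + n + z) (sym p≡))
    where
    lemma : ∀ x n → x ≡ - n + (x + n)
    lemma = solve-∀
  hi≡ : r₂ n ≡ r₁ n + + L - 1ℤ
  hi≡ = trans (lemma (r₁ n) (r₂ n)) (cong (λ z → r₁ n + z - 1ℤ) (sym L≡))
    where
    lemma : ∀ x y → y ≡ x + (y - x + 1ℤ) - 1ℤ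
    lemma = solve-∀
  total : p ℕ.+ (L ℕ.+ r) ≡ suc ((n ℕ.+ n) ℕ.+ (n ℕ.+ n))
  total = +-injective (trans (cong₂ _+_ p≡ (cong₂ _+_ L≡ r≡)) (lemma (r₁ n) (r₂ n) (+ n)))
    where
    lemma : ∀ x y n → x + n + (y - x + 1ℤ + (+ 3 * n - y)) ≡ 1ℤ + ((n + n) + (n + n))
    lemma = solve-∀

corollary1p2 : (n : ℕ) → 1 ℕ.≤ n → (m : ℕ) → m ℕ.≤ n →
    a m ≡ ∑ℤ (r₁ n) (r₂ n) (λ k →
    if does (+ 2 ∣? (k - + n))
    then (-1ℤ ^ ∣ (+ n - k) / + 2 ∣) *
    (∑[ r < m ℕ.+ (3 ℕ.* n ℕ.^ 2 ℕ.+ n) ℕ./ 2 ]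
    ((𝔪 (∣ k ∣) (toℕ r)) *
    (𝔪-odd (∣ (+ 3 * + n - k) / + 2 ∣)
    (m ℕ.+ (3 ℕ.* n ℕ.^ 2 ℕ.+ n) ℕ./ 2 ∸ toℕ r))))
    else 0ℤ)
corollary1p2 n 1≤n m m≤n = trans (⊛-identityˡ (recip Θ₆) m) (sym (∑-summand n 1≤n m m≤n))
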